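{- Let $p$ be a prime greater than $3$ and let $n$ be a positive integer not divisible by $p$. If $n\equiv 0$ or $2\pmod 3$, then $n$ is a sum of $k$ squares not divisible by $p$ for some positive integer $k\le 4$.
   Context: For a prime $p$, an integer $n$ is a sum of $k$ squares not divisible by $p$ if there are integers $x_1,\dots,x_k$ with $n=x_1^2+\cdots+x_k^2$ and $\gcd(p,x_1x_2\cdots x_k)=1$. -}

module Defs where

open import Data.Nat using (ℕ)
open import Data.Integer using (ℤ; _+_; _*_; +_)
open import Data.Integer.GCD using (gcd)
open import Data.Fin using (Fin)
open import Data.Product using (∃; _×_)
open import Relation.Binary.PropositionalEquality using (_≡_)
import Data.Vec.Functional as VF

sumSq : ∀ {k} → (Fin k → ℤ) → ℤ
sumSq x = VF.foldr _+_ (+ 0) (VF.map (λ a → a * a) x)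

prodℤ : ∀ {k} → (Fin k → ℤ) → ℤ
prodℤ x = VF.foldr _*_ (+ 1) x

IsSumOfSquaresNotDiv : ℕ → ℕ → ℤ → Set
IsSumOfSquaresNotDiv p k n =
  ∃ λ (x : Fin k → ℤ) → (n ≡ sumSq x) × gcd (+ p) (prodℤ x) ≡ + 1

{-# OPTIONS --safe #-}

-- Start from n = a² + b² + c² + d² (Lagrange). If v has three coordinates ± 1 and one 0, the reflection
-- x ↦ x - (2/3)(x·v) v is integral on the vectors with 3 ∣ x·v, and n ≢ 1 mod 3 guarantees enough such v.
-- Reflecting a triple in which p divides some but not all entries usually makes all three prime to p.
-- When a multiple of p survives, it can be chosen less divisible by 3 than before; once it is prime to 3,
-- another entry of the triple is divisible by 3, its sign is free, and one of the two signs succeeds.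
-- Only zeros may remain, and these are dropped.
--
-- The choice of sign fails only for p = 5 and b² + c² ≡ 0 mod 5, which matters only for n ≡ ± 1 mod 5.
-- There the entries may be normalised to (5a, 2d + 5b, 2d + 5c, d), with d² ≡ - n mod 5. Two configurations
-- modulo 15 resist the argument; they are moved by reflections with denominator 5. A finite check modulo 5
-- shows that this succeeds unless a quantity (5a, or the difference of the two middle entries) is divisible
-- by 25, and then that quantity can be replaced by one less divisible by 5. The process stops at the latest
-- when 5a = 0, or when both the difference and the scalar product with (1, 2, 0, 1) vanish; the latter
-- vectors have an explicit replacement.

module Submission where

open import Defs
open import Data.Nat using (ℕ; _<_; _≤_; _%_)
open import Data.Nat.Divisibility using (_∣_)
open import Data.Nat.Primality using (Prime)
open import Data.Integer using (+_)
open import Data.Product using (∃; _×_)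
open import Data.Sum using (_⊎_)
open import Relation.Nullary using (¬_)
open import Relation.Binary.PropositionalEquality using (_≡_)

open import Data.Nat using (zero; suc; s≤s; z≤n)
import Data.Nat as ℕ
import Data.Nat.DivMod as ℕ
import Data.Nat.Divisibility as ℕ
import Data.Nat.GCD as ℕ
import Data.Nat.Properties as ℕ
open import Data.Nat.Induction using (<-rec)
open import Data.Nat.ListAction using (product)
open import Data.Nat.Primality using (euclidsLemma; prime⇒irreducible; prime⇒nonZero; prime⇒nonTrivial)
open import Data.Nat.Primality.Factorisation using (factorise; module PrimeFactorisation)
import Data.Nat.Tactic.RingSolver as ℕ-Solver
open import Data.Integer using (ℤ; -[1+_]; _+_; _*_; _-_; -_; _^_; ∣_∣)
import Data.Integer.DivMod as ℤ
import Data.Integer.Properties as ℤ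
open import Data.Integer.Divisibility.Signed using (divides; ∣ᵤ⇒∣; ∣⇒∣ᵤ; _∣?_; ∣m∣n⇒∣m+n; ∣m∣n⇒∣m-n; ∣-refl; ∣n⇒∣m*n)
  renaming (_∣_ to _∣ℤ_)
open import Data.Integer.Tactic.RingSolver using (solve; solve-∀)
open import Data.Empty using (⊥; ⊥-elim)
open import Data.Fin using (Fin; zero; suc; toℕ; fromℕ<; splitAt; join)
import Data.Fin.Properties as Fin
open import Data.List using ([]; _∷_)
open import Data.List.Relation.Unary.All as All using (All)
open import Data.List.Relation.Unary.Any as Any using (Any)
open import Data.Product using (∃-syntax; _,_; proj₁; proj₂)
import Data.Product as Product
open import Data.Sum using (inj₁; inj₂)
import Data.Sum as Sum
import Data.Vec.Functional as VF
open import Function using (_∘_; _|>_; case_of_)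
open import Relation.Binary.Definitions using (tri<; tri≈; tri>)
open import Relation.Binary.PropositionalEquality using (_≢_; refl; sym; trans; cong; cong₂; subst)
open import Relation.Nullary using (Dec; yes; no; True; from-no; toWitness; _⊎-dec_; _×-dec_)
open import Relation.Nullary.Decidable using (map′)

-- The case p = 5 turns on the entry left out of the triple. For n ≡ ± 1 the squares of units modulo
-- 5 are ± n, so beside a single multiple of 5 the other squares are n, n and - n. Leaving out an
-- entry with square n leaves a triple of square sum 0 modulo 5, where both signs can fail. Only the
-- entry d with d² ≡ - n may be left out, and - 1 ≡ 2² makes the other two units ± 2 d. What remains
-- is to make the triple beside such an entry suitable modulo 3. Reflections with denominator 5
-- serve this because 5 is invertible modulo 3: the residues of the image modulo 3 are known in
-- advance, while its residues modulo 5 bring in the next 5-adic digits a, b, c. This is what a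
-- check over residues modulo 5 can exploit. Each descent compares two images related by a symmetry
-- that the residues modulo 3 leave free: a sign, or the exchange of the middle entries. The two
-- candidates for the next quantity differ by the present one, divided by the prime and multiplied
-- by an integer prime to it, so one of them is less divisible.

-- Congruences as linear combinations with explicit coefficients

lin₁ : ∀ {m x z} α → m ∣ℤ x → z ≡ α * x → m ∣ℤ z
lin₁ α m∣x refl = ∣n⇒∣m*n α m∣x

lin₂ : ∀ {m x y z} α β → m ∣ℤ x → m ∣ℤ y → z ≡ α * x + β * y → m ∣ℤ z
lin₂ α β m∣x m∣y refl = ∣m∣n⇒∣m+n (∣n⇒∣m*n α m∣x) (∣n⇒∣m*n β m∣y)

lin₃ : ∀ {m x y w z} α β γ → m ∣ℤ x → m ∣ℤ y → m ∣ℤ w → z ≡ α * x + β * y + γ * w → m ∣ℤ z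
lin₃ α β γ m∣x m∣y m∣w refl = ∣m∣n⇒∣m+n (lin₂ α β m∣x m∣y refl) (∣n⇒∣m*n γ m∣w)

lin₄ : ∀ {m x y w v z} α β γ δ → m ∣ℤ x → m ∣ℤ y → m ∣ℤ w → m ∣ℤ v →
  z ≡ α * x + β * y + γ * w + δ * v → m ∣ℤ z
lin₄ α β γ δ m∣x m∣y m∣w m∣v refl = ∣m∣n⇒∣m+n (lin₃ α β γ m∣x m∣y m∣w refl) (∣n⇒∣m*n δ m∣v)

lin₅ : ∀ {m x y w v u z} α β γ δ ε → m ∣ℤ x → m ∣ℤ y → m ∣ℤ w → m ∣ℤ v → m ∣ℤ u →
  z ≡ α * x + β * y + γ * w + δ * v + ε * u → m ∣ℤ z
lin₅ α β γ δ ε m∣x m∣y m∣w m∣v m∣u refl = ∣m∣n⇒∣m+n (lin₄ α β γ δ m∣x m∣y m∣w m∣v refl) (∣n⇒∣m*n ε m∣u)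

-- Lagrange's four-square theorem

record Rep (n a b c d : ℤ) : Set where
  constructor rep
  field sum≡ : a * a + b * b + c * c + d * d ≡ n

open Rep

FourSquares : ℤ → Set
FourSquares n = ∃[ a ] ∃[ b ] ∃[ c ] ∃[ d ] Rep n a b c d

euler : ∀ {m n a b c d e f g h} → Rep m a b c d → Rep n e f g h →
  Rep (m * n) (a * e + b * f + c * g + d * h) (a * f - b * e + c * h - d * g)
              (a * g - c * e + d * f - b * h) (a * h - d * e + b * g - c * f)
euler {a = a} {b} {c} {d} {e} {f} {g} {h} (rep refl) (rep refl) = rep (id a b c d e f g h)
  where
  id : ∀ a b c d e f g h →
    (a * e + b * f + c * g + d * h) * (a * e + b * f + c * g + d * h)
    + (a * f - b * e + c * h - d * g) * (a * f - b * e + c * h - d * g)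
    + (a * g - c * e + d * f - b * h) * (a * g - c * e + d * f - b * h)
    + (a * h - d * e + b * g - c * f) * (a * h - d * e + b * g - c * f) ≡
    (a * a + b * b + c * c + d * d) * (e * e + f * f + g * g + h * h)
  id = solve-∀

fourSquares-* : ∀ {m n} → FourSquares m → FourSquares n → FourSquares (m * n)
fourSquares-* (_ , _ , _ , _ , r) (_ , _ , _ , _ , s) = _ , _ , _ , _ , euler r s

-- The bound |2 y| ≤ m for y = x - k m is recorded by natural numbers instead of inequalities:
-- `u * v` equals m² - 4 y², and the descent needs both its sign and the case where it vanishes.
record Centred (m : ℕ) (x : ℤ) : Set where
  constructor centred
  field
    k     : ℤ
    u v   : ℕ
    below : + m - + 2 * (x - k * + m) ≡ + u
    above : + m + + 2 * (x - k * + m) ≡ + v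

centre : ∀ m .{{_ : ℕ.NonZero m}} x → Centred m x
centre m x = go (x ℤ.%ℕ m) (ℤ.a≡a%ℕn+[a/ℕn]*n x m) (ℤ.n%ℕd<d x m)
  where
  q = x ℤ./ℕ m

  id₁ : ∀ r t q → r + r + t - + 2 * (r + q * (r + r + t) - q * (r + r + t)) ≡ t
  id₁ = solve-∀

  id₂ : ∀ r t q → r + r + t + + 2 * (r + q * (r + r + t) - q * (r + r + t)) ≡ r + r + t + (r + r)
  id₂ = solve-∀

  id₃ : ∀ r s q → r + s - + 2 * (r + q * (r + s) - (q + + 1) * (r + s)) ≡ r + s + (s + s)
  id₃ = solve-∀

  id₄ : ∀ s t q → s + t + s + + 2 * (s + t + q * (s + t + s) - (q + + 1) * (s + t + s)) ≡ t
  id₄ = solve-∀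

  go : ∀ {m x} r → x ≡ + r + q * + m → r < m → Centred m x
  go {m} r refl r<m with r ℕ.+ r ℕ.≤? m
  ... | yes 2r≤m with t , refl ← ℕ.m≤n⇒∃[o]m+o≡n 2r≤m =
    centred q _ _ (id₁ (+ r) (+ t) q) (id₂ (+ r) (+ t) q)
  ... | no 2r≰m with s , refl ← ℕ.m≤n⇒∃[o]m+o≡n (ℕ.<⇒≤ r<m)
                   | t , eq ← ℕ.m≤n⇒∃[o]m+o≡n (ℕ.<⇒≤ (ℕ.≰⇒> 2r≰m))
    with refl ← ℕ.+-cancelˡ-≡ r (s ℕ.+ t) r (trans (sym (ℕ.+-assoc r s t)) eq) =
    centred (q + + 1) _ _ (id₃ (+ r) (+ s) q) (id₄ (+ s) (+ t) q)

nonNeg-factor : ∀ m .{{_ : ℕ.NonZero m}} z {s} → + m * z ≡ + s → ∃[ t ] z ≡ + t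
nonNeg-factor (suc m) (+ t) eq = t , refl
nonNeg-factor (suc m) -[1+ t ] ()

square : ∀ x → x * x ≡ + (∣ x ∣ ℕ.* ∣ x ∣)
square (+ x) = sym (ℤ.pos-* x x)
square -[1+ x ] = refl

sum4≡0 : ∀ {a b c d : ℕ} → a ℕ.+ b ℕ.+ c ℕ.+ d ≡ 0 → a ≡ 0 × b ≡ 0 × c ≡ 0 × d ≡ 0
sum4≡0 {zero} {zero} {zero} {zero} eq = refl , refl , refl , refl

cong₄ : ∀ {A : Set} (f : A → A → A → A → A) {a a′ b b′ c c′ d d′} →
  a ≡ a′ → b ≡ b′ → c ≡ c′ → d ≡ d′ → f a b c d ≡ f a′ b′ c′ d′
cong₄ f refl refl refl refl = refl

sumSquares : ∀ a b c d → a * a + b * b + c * c + d * d ≡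
  + (∣ a ∣ ℕ.* ∣ a ∣ ℕ.+ ∣ b ∣ ℕ.* ∣ b ∣ ℕ.+ ∣ c ∣ ℕ.* ∣ c ∣ ℕ.+ ∣ d ∣ ℕ.* ∣ d ∣)
sumSquares a b c d = cong₄ (λ x y z w → x + y + z + w) (square a) (square b) (square c) (square d)

sumSquares≡0 : ∀ {a b c d} → Rep (+ 0) a b c d → a ≡ + 0 × b ≡ + 0 × c ≡ + 0 × d ≡ + 0
sumSquares≡0 {a} {b} {c} {d} (rep r)
  with p , q , s , t ← sum4≡0 {∣ a ∣ ℕ.* ∣ a ∣} (ℤ.+-injective (trans (sym (sumSquares a b c d)) r)) =
  root a p , root b q , root c s , root d t
  where
  root : ∀ x → ∣ x ∣ ℕ.* ∣ x ∣ ≡ 0 → x ≡ + 0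
  root x eq with ℕ.m*n≡0⇒m≡0∨n≡0 ∣ x ∣ eq
  ... | inj₁ e = ℤ.∣i∣≡0⇒i≡0 e
  ... | inj₂ e = ℤ.∣i∣≡0⇒i≡0 e

-- The usual division of Euler's product by m² is avoided. As quaternions with y = x - m k, one has
-- x ȳ = m (q - x k̄), so q - x k̄ has norm r q, where m r is the norm of y.
module Descent (m q : ℕ) .{{_ : ℕ.NonZero m}} (m∤q : ¬ + m ∣ℤ + q) {x₁ x₂ x₃ x₄ : ℤ}
  (X : Rep (+ m * + q) x₁ x₂ x₃ x₄)
  (C₁ : Centred m x₁) (C₂ : Centred m x₂) (C₃ : Centred m x₃) (C₄ : Centred m x₄) where

  open Centred C₁ renaming (k to k₁; u to u₁; v to v₁; below to below₁; above to above₁)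
  open Centred C₂ renaming (k to k₂; u to u₂; v to v₂; below to below₂; above to above₂)
  open Centred C₃ renaming (k to k₃; u to u₃; v to v₃; below to below₃; above to above₃)
  open Centred C₄ renaming (k to k₄; u to u₄; v to v₄; below to below₄; above to above₄)

  M = + m
  Q = + q
  y₁ = x₁ - k₁ * M
  y₂ = x₂ - k₂ * M
  y₃ = x₃ - k₃ * M
  y₄ = x₄ - k₄ * M
  xk = x₁ * k₁ + x₂ * k₂ + x₃ * k₃ + x₄ * k₄
  kk = k₁ * k₁ + k₂ * k₂ + k₃ * k₃ + k₄ * k₄
  r = Q - + 2 * xk + M * kk

  K : Rep kk k₁ k₂ k₃ k₄
  K = rep refl

  -- The coordinates of x k̄, with the first one subtracted from q.
  improved : FourSquares (r * Q)
  improved = _ , _ , _ , _ , shift (euler X K)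
    where
    id : ∀ Q a b c d → (Q - a) * (Q - a) + b * b + c * c + d * d ≡ Q * Q - + 2 * Q * a + (a * a + b * b + c * c + d * d)
    id = solve-∀
    dist : ∀ M Q a b → Q * Q - + 2 * Q * a + M * Q * b ≡ (Q - + 2 * a + M * b) * Q
    dist = solve-∀
    shift : ∀ {b c d} → Rep (M * Q * kk) xk b c d → Rep (r * Q) (Q - xk) b c d
    shift {b} {c} {d} (rep s) =
      rep (trans (id Q xk b c d) (trans (cong (λ z → Q * Q - + 2 * Q * xk + z) s) (dist M Q xk kk)))

  Y : Rep (M * r) y₁ y₂ y₃ y₄
  Y = rep (trans (expand x₁ x₂ x₃ x₄ k₁ k₂ k₃ k₄ M)
    (trans (cong (λ X → X - + 2 * M * xk + M * M * kk) (sum≡ X)) (dist M Q xk kk)))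
    where
    expand : ∀ a b c d e f g h M →
      (a - e * M) * (a - e * M) + (b - f * M) * (b - f * M) + (c - g * M) * (c - g * M) + (d - h * M) * (d - h * M)
      ≡ a * a + b * b + c * c + d * d - + 2 * M * (a * e + b * f + c * g + d * h) + M * M * (e * e + f * f + g * g + h * h)
    expand = solve-∀
    dist : ∀ M Q a b → M * Q - + 2 * M * a + M * M * b ≡ M * (Q - + 2 * a + M * b)
    dist = solve-∀

  -- As 4 m r is the sum of the (2 yᵢ)², the left side is the sum of the m² - (2 yᵢ)². This yields r
  -- ≤ m, and r = m forces every `uᵢ * vᵢ` to vanish.
  gap : + 4 * M * (M - r) ≡ + (u₁ ℕ.* v₁ ℕ.+ u₂ ℕ.* v₂ ℕ.+ u₃ ℕ.* v₃ ℕ.+ u₄ ℕ.* v₄)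
  gap = trans (dist M r) (trans (cong (λ Y → + 4 * M * M - + 4 * Y) (sym (sum≡ Y)))
    (trans (id y₁ y₂ y₃ y₄ M) (cong₄ (λ a b c d → a + b + c + d)
      (uv C₁) (uv C₂) (uv C₃) (uv C₄))))
    where
    dist : ∀ M r → + 4 * M * (M - r) ≡ + 4 * M * M - + 4 * (M * r)
    dist = solve-∀
    id : ∀ a b c d M → + 4 * M * M - + 4 * (a * a + b * b + c * c + d * d) ≡
      (M - + 2 * a) * (M + + 2 * a) + (M - + 2 * b) * (M + + 2 * b) + (M - + 2 * c) * (M + + 2 * c) + (M - + 2 * d) * (M + + 2 * d)
    id = solve-∀
    uv : ∀ {x} (C : Centred m x) → let open Centred C in
      (M - + 2 * (x - k * M)) * (M + + 2 * (x - k * M)) ≡ + (u ℕ.* v)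
    uv C = let open Centred C in trans (cong₂ _*_ below above) (sym (ℤ.pos-* u v))

  -- In the extreme cases r = 0 and r = m, each 2 yᵢ is a multiple of m.
  extreme : M ∣ℤ r → M ∣ℤ + 2 * y₁ → M ∣ℤ + 2 * y₂ → M ∣ℤ + 2 * y₃ → M ∣ℤ + 2 * y₄ → ⊥
  extreme m∣r m∣y₁ m∣y₂ m∣y₃ m∣y₄ = m∤q (subst (M ∣ℤ_) (sym (id x₁ x₂ x₃ x₄ k₁ k₂ k₃ k₄ M Q))
    (∣m∣n⇒∣m+n (lin₂ (+ 1) kk m∣r ∣-refl refl) (lin₄ k₁ k₂ k₃ k₄ m∣y₁ m∣y₂ m∣y₃ m∣y₄ refl)))
    where
    id : ∀ a b c d e f g h M Q → Q ≡
      (+ 1 * (Q - + 2 * (a * e + b * f + c * g + d * h) + M * (e * e + f * f + g * g + h * h)) + (e * e + f * f + g * g + h * h) * M)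
      + (e * (+ 2 * (a - e * M)) + f * (+ 2 * (b - f * M)) + g * (+ 2 * (c - g * M)) + h * (+ 2 * (d - h * M)))
    id = solve-∀

  r≡0 : r ≡ + 0 → ⊥
  r≡0 r≡0 =
    let y₁≡0 , y₂≡0 , y₃≡0 , y₄≡0 = sumSquares≡0 (rep (trans (sum≡ Y) (trans (cong (M *_) r≡0) (ℤ.*-zeroʳ M)))) in
    extreme (subst (M ∣ℤ_) (sym r≡0) M∣0) (twice y₁≡0) (twice y₂≡0) (twice y₃≡0) (twice y₄≡0)
    where
    M∣0 : M ∣ℤ + 0
    M∣0 = divides (+ 0) refl
    twice : ∀ {y} → y ≡ + 0 → M ∣ℤ + 2 * y
    twice refl = M∣0

  r≡m : r ≡ M → ⊥
  r≡m r≡m =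
    let p₁ , p₂ , p₃ , p₄ = sum4≡0 {u₁ ℕ.* v₁} gap≡0 in
    extreme (subst (M ∣ℤ_) (sym r≡m) ∣-refl) (twice C₁ p₁) (twice C₂ p₂) (twice C₃ p₃) (twice C₄ p₄)
    where
    id : ∀ M → + 4 * M * (M - M) ≡ + 0
    id = solve-∀
    gap≡0 : u₁ ℕ.* v₁ ℕ.+ u₂ ℕ.* v₂ ℕ.+ u₃ ℕ.* v₃ ℕ.+ u₄ ℕ.* v₄ ≡ 0
    gap≡0 = ℤ.+-injective (trans (sym gap) (trans (cong (λ r → + 4 * M * (M - r)) r≡m) (id M)))
    id₁ : ∀ y M → + 2 * y ≡ + 1 * M + - + 1 * (M - + 2 * y)
    id₁ = solve-∀
    id₂ : ∀ y M → + 2 * y ≡ - + 1 * M + + 1 * (M + + 2 * y)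
    id₂ = solve-∀
    twice : ∀ {x} (C : Centred m x) → let open Centred C in u ℕ.* v ≡ 0 → M ∣ℤ + 2 * (x - k * M)
    twice {x} (centred k u v below above) uv≡0 with ℕ.m*n≡0⇒m≡0∨n≡0 u uv≡0
    ... | inj₁ refl = lin₂ (+ 1) (- + 1) ∣-refl (divides (+ 0) below) (id₁ (x - k * M) M)
    ... | inj₂ refl = lin₂ (- + 1) (+ 1) ∣-refl (divides (+ 0) above) (id₂ (x - k * M) M)

  descend : ∃[ r′ ] 0 < r′ × r′ < m × FourSquares (+ r′ * Q)
  descend = r′ , r′>0 , r′<m , subst (λ r → FourSquares (r * Q)) r≡r′ improved
    where
    nonNeg-r = nonNeg-factor m r (trans (sym (sum≡ Y)) (sumSquares y₁ y₂ y₃ y₄))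
    r′ = proj₁ nonNeg-r
    r≡r′ = proj₂ nonNeg-r
    nonNeg-m-r = nonNeg-factor (4 ℕ.* m) {{ℕ.m*n≢0 4 m}} (M - r) (trans (cong (_* (M - r)) (ℤ.pos-* 4 m)) gap)
    s = proj₁ nonNeg-m-r
    m-r≡s = proj₂ nonNeg-m-r
    id : ∀ M r → M ≡ r + (M - r)
    id = solve-∀
    m≡r′+s : m ≡ r′ ℕ.+ s
    m≡r′+s = ℤ.+-injective (trans (id M r) (cong₂ _+_ r≡r′ m-r≡s))
    r′>0 : 0 < r′
    r′>0 = ℕ.n≢0⇒n>0 λ r′≡0 → r≡0 (trans r≡r′ (cong +_ r′≡0))
    r′<m : r′ < m
    r′<m = subst (r′ <_) (sym m≡r′+s) (ℕ.m<m+n r′ (ℕ.n≢0⇒n>0 λ s≡0 → r≡m (trans r≡r′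
      (cong +_ (sym (trans m≡r′+s (trans (cong (r′ ℕ.+_) s≡0) (ℕ.+-identityʳ r′))))))))

descent : ∀ {q} → Prime q → ∀ m → 0 < m → m < q → FourSquares (+ m * + q) → FourSquares (+ q)
descent {q} q-prime = <-rec _ go
  where
  go : ∀ m → (∀ {r} → r < m → 0 < r → r < q → FourSquares (+ r * + q) → FourSquares (+ q)) →
    0 < m → m < q → FourSquares (+ m * + q) → FourSquares (+ q)
  go 1 ih _ _ s = subst FourSquares (ℤ.*-identityˡ (+ q)) s
  go m@(suc (suc _)) ih _ m<q (_ , _ , _ , _ , X) =
    let r , 0<r , r<m , s = D.descend in ih r<m 0<r (ℕ.<-trans r<m m<q) s
    where
    m∤q : ¬ + m ∣ℤ + q
    m∤q m∣q with prime⇒irreducible q-prime (∣⇒∣ᵤ m∣q)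
    ... | inj₂ m≡q = ℕ.<-irrefl m≡q m<q
    module D = Descent m q m∤q X (centre m _) (centre m _) (centre m _) (centre m _)

module _ {q : ℕ} (q-prime : Prime q) where

  private instance
    q≢0 : ℕ.NonZero q
    q≢0 = prime⇒nonZero q-prime

  prime-∣ℤ-* : ∀ x y → + q ∣ℤ x * y → + q ∣ℤ x ⊎ + q ∣ℤ y
  prime-∣ℤ-* x y q∣xy with euclidsLemma ∣ x ∣ ∣ y ∣ q-prime (subst (q ∣_) (ℤ.abs-* x y) (∣⇒∣ᵤ q∣xy))
  ... | inj₁ q∣x = inj₁ (∣ᵤ⇒∣ q∣x)
  ... | inj₂ q∣y = inj₂ (∣ᵤ⇒∣ q∣y)

  %ℕ-≡⇒∣ : ∀ x y → x ℤ.%ℕ q ≡ y ℤ.%ℕ q → + q ∣ℤ x - y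
  %ℕ-≡⇒∣ x y eq = divides (x ℤ./ℕ q - y ℤ./ℕ q)
    (trans (cong₂ _-_ (ℤ.a≡a%ℕn+[a/ℕn]*n x q) (ℤ.a≡a%ℕn+[a/ℕn]*n y q))
      (trans (cong (λ r → + (x ℤ.%ℕ q) + x ℤ./ℕ q * + q - (+ r + y ℤ./ℕ q * + q)) (sym eq))
        (id (+ (x ℤ.%ℕ q)) (x ℤ./ℕ q) (y ℤ./ℕ q) (+ q))))
    where
    id : ∀ r a b q → r + a * q - (r + b * q) ≡ (a - b) * q
    id = solve-∀

  -- Squares of 0, …, h and the numbers -1 - j² for j = 0, …, h are too many to be distinct mod 2h + 1.
  private module _ (g : ℕ) (q≡ : q ≡ suc (suc g ℕ.+ suc g)) where

    h = suc g

    value : Fin (suc h) ⊎ Fin (suc h) → ℤ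
    value (inj₁ i) = + toℕ i * + toℕ i
    value (inj₂ j) = - + 1 - + toℕ j * + toℕ j

    toℕ≤h : (i : Fin (suc h)) → toℕ i ≤ h
    toℕ≤h i = ℕ.≤-pred (Fin.toℕ<n i)

    distinct-squares : ∀ i j → i < j → j ≤ h → ¬ + q ∣ℤ + i * + i - + j * + j
    distinct-squares i j i<j j≤h q∣ with k , refl ← ℕ.m≤n⇒∃[o]m+o≡n (ℕ.<⇒≤ i<j)
      with prime-∣ℤ-* (+ k) (+ (i ℕ.+ (i ℕ.+ k))) (lin₁ (- + 1) q∣ (id (+ i) (+ k)))
      where
      id : ∀ i k → k * (i + (i + k)) ≡ - + 1 * (i * i - (i + k) * (i + k))
      id = solve-∀
    ... | inj₁ q∣k = ℕ.>⇒∤ {{ℕ.>-nonZero 0<k}} k<q (∣⇒∣ᵤ q∣k)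
      where
      0<k : 0 < k
      0<k = ℕ.+-cancelˡ-< i 0 k (subst (_< i ℕ.+ k) (sym (ℕ.+-identityʳ i)) i<j)
      k<q : k < q
      k<q = subst (k <_) (sym q≡) (s≤s (ℕ.≤-trans (ℕ.m≤n+m k i) (ℕ.≤-trans j≤h (ℕ.m≤m+n h h))))
    ... | inj₂ q∣s = ℕ.>⇒∤ {{ℕ.>-nonZero (ℕ.<-≤-trans (ℕ.≤-<-trans z≤n i<j) (ℕ.m≤n+m _ i))}} s<q (∣⇒∣ᵤ q∣s)
      where
      s<q : i ℕ.+ (i ℕ.+ k) < q
      s<q = subst (i ℕ.+ (i ℕ.+ k) <_) (sym q≡) (s≤s (ℕ.+-mono-≤ (ℕ.≤-trans (ℕ.<⇒≤ i<j) j≤h) j≤h))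

    injective-squares : (a b : Fin (suc h)) → a ≢ b → ¬ + q ∣ℤ + toℕ a * + toℕ a - + toℕ b * + toℕ b
    injective-squares a b a≢b q∣ with ℕ.<-cmp (toℕ a) (toℕ b)
    ... | tri< a<b _ _ = distinct-squares (toℕ a) (toℕ b) a<b (toℕ≤h b) q∣
    ... | tri≈ _ a≡b _ = a≢b (Fin.toℕ-injective a≡b)
    ... | tri> _ _ b<a = distinct-squares (toℕ b) (toℕ a) b<a (toℕ≤h a) (lin₁ (- + 1) q∣ (id (+ toℕ a) (+ toℕ b)))
      where
      id : ∀ a b → b * b - a * a ≡ - + 1 * (a * a - b * b)
      id = solve-∀

    Multiple : Set
    Multiple = ∃[ m ] 0 < m × m < q × FourSquares (+ m * + q)

    multiple : ∀ i j → i ≤ h → j ≤ h → + q ∣ℤ + 1 + + i * + i + + j * + j → Multiple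
    multiple i j i≤h j≤h q∣ with ∣⇒∣ᵤ (subst (+ q ∣ℤ_) (cong₂ (λ a b → + 1 + a + b) (square (+ i)) (square (+ j))) q∣)
    ... | ℕ.divides m eq = m , 0<m , m<q , + i , + j , + 1 , + 0 ,
      rep (trans (id (+ i) (+ j)) (trans (cong₂ (λ a b → + 1 + a + b) (square (+ i)) (square (+ j))) (trans (cong +_ eq) (ℤ.pos-* m q))))
      where
      id : ∀ i j → i * i + j * j + + 1 * + 1 + + 0 * + 0 ≡ + 1 + i * i + j * j
      id = solve-∀
      -- The surplus of q² = (2 h + 1)² over 1 + 2 h² is 2 h² + 4 h, expanded in g = h - 1. It is
      -- positive because h ≥ 1.
      id₂ : ∀ g → suc (suc g ℕ.+ suc g) ℕ.* suc (suc g ℕ.+ suc g) ≡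
        1 ℕ.+ suc g ℕ.* suc g ℕ.+ suc g ℕ.* suc g ℕ.+ suc (5 ℕ.+ 8 ℕ.* g ℕ.+ 2 ℕ.* (g ℕ.* g))
      id₂ = ℕ-Solver.solve-∀
      0<m : 0 < m
      0<m = ℕ.n≢0⇒n>0 λ { refl → case eq of λ () }
      m<q : m < q
      m<q = ℕ.*-cancelʳ-< q m q (ℕ.≤-<-trans (ℕ.≤-reflexive (sym eq))
        (ℕ.≤-<-trans (ℕ.+-mono-≤ (ℕ.+-monoʳ-≤ 1 (ℕ.*-mono-≤ i≤h i≤h)) (ℕ.*-mono-≤ j≤h j≤h))
        (subst (λ q → 1 ℕ.+ h ℕ.* h ℕ.+ h ℕ.* h < q ℕ.* q) (sym q≡)
          (subst (1 ℕ.+ h ℕ.* h ℕ.+ h ℕ.* h <_) (sym (id₂ g)) (ℕ.m<m+n _ (s≤s z≤n))))))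

    q<2h+2 : q < suc h ℕ.+ suc h
    q<2h+2 = subst (_< suc h ℕ.+ suc h) (sym q≡) (s≤s (ℕ.≤-reflexive (sym (ℕ.+-suc h h))))

    multiple-ofSumOfSquares : Multiple
    multiple-ofSumOfSquares
      with i , j , i<j , fi≡fj ← Fin.pigeonhole q<2h+2 (λ i → fromℕ< (ℤ.n%ℕd<d (value (splitAt (suc h) i)) q))
      with splitAt (suc h) i in i≡ | splitAt (suc h) j in j≡
         | %ℕ-≡⇒∣ (value (splitAt (suc h) i)) (value (splitAt (suc h) j)) (trans (sym (Fin.toℕ-fromℕ< _)) (trans (cong toℕ fi≡fj) (Fin.toℕ-fromℕ< _)))
    ... | inj₁ a | inj₂ b | q∣ = multiple (toℕ a) (toℕ b) (toℕ≤h a) (toℕ≤h b) (lin₁ (+ 1) q∣ (id (+ toℕ a) (+ toℕ b)))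
      where
      id : ∀ a b → + 1 + a * a + b * b ≡ + 1 * (a * a - (- + 1 - b * b))
      id = solve-∀
    ... | inj₂ a | inj₁ b | q∣ = multiple (toℕ a) (toℕ b) (toℕ≤h a) (toℕ≤h b) (lin₁ (- + 1) q∣ (id (+ toℕ a) (+ toℕ b)))
      where
      id : ∀ a b → + 1 + a * a + b * b ≡ - + 1 * ((- + 1 - a * a) - b * b)
      id = solve-∀
    ... | inj₁ a | inj₁ b | q∣ = ⊥-elim (injective-squares a b a≢b q∣)
      where
      a≢b : a ≢ b
      a≢b refl = Fin.<⇒≢ i<j (trans (sym (Fin.join-splitAt (suc h) (suc h) i)) (trans (cong (join (suc h) (suc h)) (trans i≡ (sym j≡))) (Fin.join-splitAt (suc h) (suc h) j)))
    ... | inj₂ a | inj₂ b | q∣ = ⊥-elim (injective-squares b a (a≢b ∘ sym) (lin₁ (+ 1) q∣ (id (+ toℕ a) (+ toℕ b))))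
      where
      id : ∀ a b → b * b - a * a ≡ + 1 * ((- + 1 - a * a) - (- + 1 - b * b))
      id = solve-∀
      a≢b : a ≢ b
      a≢b refl = Fin.<⇒≢ i<j (trans (sym (Fin.join-splitAt (suc h) (suc h) i)) (trans (cong (join (suc h) (suc h)) (trans i≡ (sym j≡))) (Fin.join-splitAt (suc h) (suc h) j)))

  fourSquares-prime : FourSquares (+ q)
  fourSquares-prime with q ℕ.% 2 | q ℕ./ 2 | ℕ.m≡m%n+[m/n]*n q 2 | ℕ.m%n<n q 2
  ... | 0 | h | q≡ | _ with prime⇒irreducible q-prime (ℕ.divides h q≡)
  ...   | inj₂ 2≡q = + 1 , + 1 , + 0 , + 0 , rep (cong +_ 2≡q)
  fourSquares-prime | 1 | zero | q≡ | _ = ⊥-elim (ℕ.nonTrivial⇒≢1 {{prime⇒nonTrivial q-prime}} q≡)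
  fourSquares-prime | 1 | suc g | q≡ | _ =
    let m , 0<m , m<q , s = multiple-ofSumOfSquares g (trans q≡ (id g)) in descent q-prime m 0<m m<q s
    where
    id : ∀ g → 1 ℕ.+ suc g ℕ.* 2 ≡ suc (suc g ℕ.+ suc g)
    id = ℕ-Solver.solve-∀
  fourSquares-prime | suc (suc _) | _ | _ | s≤s (s≤s ())

lagrange : ∀ n → FourSquares (+ n)
lagrange zero = + 0 , + 0 , + 0 , + 0 , rep refl
lagrange n@(suc _) = subst (λ k → FourSquares (+ k)) (sym isFactorisation) (go factors factorsPrime)
  where
  open PrimeFactorisation (factorise n)
  go : ∀ ps → All Prime ps → FourSquares (+ product ps)
  go [] All.[] = + 1 , + 0 , + 0 , + 0 , rep refl
  go (p ∷ ps) (p-prime All.∷ ps-prime) =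
    subst FourSquares (sym (ℤ.pos-* p (product ps))) (fourSquares-* (fourSquares-prime p-prime) (go ps ps-prime))

-- Reflections with denominator 3

record Rep₃ (n a b c : ℤ) : Set where
  constructor rep₃
  field sum₃≡ : a * a + b * b + c * c ≡ n

open Rep₃

T : ℤ → Set
T x = + 3 ∣ℤ x

mod3 : ∀ x → T x ⊎ T (x - + 1) ⊎ T (x + + 1)
mod3 x = go (x ℤ.%ℕ 3) (x ℤ./ℕ 3) (ℤ.a≡a%ℕn+[a/ℕn]*n x 3) (ℤ.n%ℕd<d x 3)
  where
  id₁ : ∀ q → + 1 + q * + 3 - + 1 ≡ q * + 3
  id₁ = solve-∀
  id₂ : ∀ q → + 2 + q * + 3 + + 1 ≡ (q + + 1) * + 3
  id₂ = solve-∀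
  go : ∀ r q → x ≡ + r + q * + 3 → r < 3 → T x ⊎ T (x - + 1) ⊎ T (x + + 1)
  go 0 q eq _ = inj₁ (divides q (trans eq (ℤ.+-identityˡ _)))
  go 1 q eq _ = inj₂ (inj₁ (divides q (trans (cong (_- + 1) eq) (id₁ q))))
  go 2 q eq _ = inj₂ (inj₂ (divides (q + + 1) (trans (cong (_+ + 1) eq) (id₂ q))))
  go (suc (suc (suc _))) _ _ (s≤s (s≤s (s≤s ())))

T-triple : ∀ x → T (+ 3 * x)
T-triple x = divides x (ℤ.*-comm (+ 3) x)

unit3 : ∀ {x} → ¬ T x → T (x - + 1) ⊎ T (x + + 1)
unit3 {x} ¬Tx with mod3 x
... | inj₁ Tx = ⊥-elim (¬Tx Tx)
... | inj₂ r = r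

trichotomy3 : ∀ x {y} → ¬ T y → T x ⊎ T (x - y) ⊎ T (x + y)
trichotomy3 x {y} ¬Ty with mod3 x | unit3 ¬Ty
... | inj₁ Tx | _ = inj₁ Tx
... | inj₂ (inj₁ r) | inj₁ s = inj₂ (inj₁ (lin₂ (+ 1) (- + 1) r s (solve (x ∷ y ∷ []))))
... | inj₂ (inj₂ r) | inj₂ s = inj₂ (inj₁ (lin₂ (+ 1) (- + 1) r s (solve (x ∷ y ∷ []))))
... | inj₂ (inj₁ r) | inj₂ s = inj₂ (inj₂ (lin₂ (+ 1) (+ 1) r s (solve (x ∷ y ∷ []))))
... | inj₂ (inj₂ r) | inj₁ s = inj₂ (inj₂ (lin₂ (+ 1) (+ 1) r s (solve (x ∷ y ∷ []))))

T± : ∀ {x y} → ¬ T x → ¬ T y → T (x + y) ⊎ T (x + - y)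
T± {x} ¬Tx ¬Ty with trichotomy3 x ¬Ty
... | inj₁ Tx = ⊥-elim (¬Tx Tx)
... | inj₂ (inj₁ r) = inj₂ r
... | inj₂ (inj₂ r) = inj₁ r

T-square-1 : ∀ {x} → ¬ T x → T (x * x - + 1)
T-square-1 {x} ¬Tx = go (unit3 ¬Tx)
  where
  go : T (x - + 1) ⊎ T (x + + 1) → T (x * x - + 1)
  go (inj₁ r) = lin₁ (x + + 1) r (solve (x ∷ []))
  go (inj₂ r) = lin₁ (x - + 1) r (solve (x ∷ []))

neg-∣ : ∀ {m x} → m ∣ℤ - x → m ∣ℤ x
neg-∣ {x = x} r = lin₁ (- + 1) r (solve (x ∷ []))

data OneMultiple (a b c : ℤ) : Set where
  first  : T a → ¬ T b → ¬ T c → OneMultiple a b c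
  second : ¬ T a → T b → ¬ T c → OneMultiple a b c
  third  : ¬ T a → ¬ T b → T c → OneMultiple a b c

third≡ : ∀ a b {c} k → a + b + c ≡ k * + 3 → c ≡ k * + 3 - a - b
third≡ a b {c} k eq = trans (id a b c) (cong (λ s → s - a - b) eq)
  where
  id : ∀ a b c → c ≡ a + b + c - a - b
  id = solve-∀

either : ∀ {A B C : Set} → A ⊎ B → (A → C) → (B → C) → C
either (inj₁ a) f g = f a
either (inj₂ b) f g = g b

-- The reflection in (1, 1, 1), where the scalar product is 3 k. The other vectors v are reached by
-- permuting coordinates and changing signs beforehand.
reflect : ∀ {n a b c k} → Rep₃ n a b c → a + b + c ≡ k * + 3 → Rep₃ n (a - + 2 * k) (b - + 2 * k) (c - + 2 * k)
reflect {a = a} {b} {c} {k} (rep₃ refl) eq = rep₃ (trans (id₁ a b c k) (trans (cong (λ s → a * a + b * b + c * c + + 4 * k * (k * + 3 - s)) eq) (id₂ a b c k)))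
  where
  id₁ : ∀ a b c k → (a - + 2 * k) * (a - + 2 * k) + (b - + 2 * k) * (b - + 2 * k) + (c - + 2 * k) * (c - + 2 * k) ≡
    a * a + b * b + c * c + + 4 * k * (k * + 3 - (a + b + c))
  id₁ = solve-∀
  id₂ : ∀ a b c k → a * a + b * b + c * c + + 4 * k * (k * + 3 - k * + 3) ≡ a * a + b * b + c * c
  id₂ = solve-∀

-- The reflection preserves the sum of squares, which is 2 modulo 3 exactly when one of three
-- entries is a multiple of 3, so the pattern has to persist. As c ≡ - b modulo 3, the residue of k
-- relative to b decides which entry it is.
reflect-oneMultiple : ∀ {a b c k} → a + b + c ≡ k * + 3 → T a → ¬ T b → ¬ T c →
  OneMultiple (a - + 2 * k) (b - + 2 * k) (c - + 2 * k)
reflect-oneMultiple {a} {b} {c} {k} eq Ta ¬Tb ¬Tc = go (trichotomy3 k ¬Tb)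
  where
  go : T k ⊎ T (k - b) ⊎ T (k + b) → OneMultiple (a - + 2 * k) (b - + 2 * k) (c - + 2 * k)
  go (inj₁ Tk) = first
    (lin₂ (+ 1) (- + 2) Ta Tk (solve (a ∷ k ∷ [])))
    (λ r → ¬Tb (lin₂ (+ 1) (+ 2) r Tk (solve (b ∷ k ∷ []))))
    (λ r → ¬Tc (lin₂ (+ 1) (+ 2) r Tk (solve (c ∷ k ∷ []))))
  go (inj₂ (inj₁ k≡b)) = third
    (λ r → ¬Tb (lin₄ (+ 1) (- + 1) (+ 2) (+ 1) r Ta k≡b (T-triple b) (solve (a ∷ b ∷ k ∷ []))))
    (λ r → ¬Tb (lin₂ (- + 1) (- + 2) r k≡b (solve (b ∷ k ∷ []))))
    (lin₄ (+ 1) (- + 1) (- + 2) (- + 1) (divides k eq) Ta k≡b (T-triple b) (solve (a ∷ b ∷ c ∷ k ∷ [])))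
  go (inj₂ (inj₂ k≡-b)) = second
    (λ r → ¬Tb (lin₄ (- + 1) (+ 1) (- + 2) (+ 1) r Ta k≡-b (T-triple b) (solve (a ∷ b ∷ k ∷ []))))
    (lin₂ (- + 2) (+ 1) k≡-b (T-triple b) (solve (b ∷ k ∷ [])))
    (λ r → ¬Tb (lin₄ (+ 1) (- + 1) (+ 1) (+ 2) r (divides k eq) Ta k≡-b (solve (a ∷ b ∷ c ∷ k ∷ []))))

oneMultiple-swap₁₂ : ∀ {a b c} → OneMultiple a b c → OneMultiple b a c
oneMultiple-swap₁₂ (first x y z) = second y x z
oneMultiple-swap₁₂ (second x y z) = first y x z
oneMultiple-swap₁₂ (third x y z) = third y x z

oneMultiple-swap₂₃ : ∀ {a b c} → OneMultiple a b c → OneMultiple a c b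
oneMultiple-swap₂₃ (first x y z) = first x z y
oneMultiple-swap₂₃ (second x y z) = third x z y
oneMultiple-swap₂₃ (third x y z) = second x z y

rep₃-swap₁₂ : ∀ {n a b c} → Rep₃ n a b c → Rep₃ n b a c
rep₃-swap₁₂ {a = a} {b} {c} (rep₃ refl) = rep₃ (id a b c)
  where
  id : ∀ a b c → b * b + a * a + c * c ≡ a * a + b * b + c * c
  id = solve-∀

rep₃-swap₂₃ : ∀ {n a b c} → Rep₃ n a b c → Rep₃ n a c b
rep₃-swap₂₃ {a = a} {b} {c} (rep₃ refl) = rep₃ (id a b c)
  where
  id : ∀ a b c → a * a + c * c + b * b ≡ a * a + b * b + c * c
  id = solve-∀

neg-square : ∀ x → - x * - x ≡ x * x
neg-square = solve-∀

rep₃-neg₁ : ∀ {n a b c} → Rep₃ n a b c → Rep₃ n (- a) b c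
rep₃-neg₁ {a = a} {b} {c} (rep₃ refl) = rep₃ (cong (λ s → s + b * b + c * c) (neg-square a))

rep₃-neg₃ : ∀ {n a b c} → Rep₃ n a b c → Rep₃ n a b (- c)
rep₃-neg₃ {a = a} {b} {c} (rep₃ refl) = rep₃ (cong (λ s → a * a + b * b + s) (neg-square c))

-- Powers of a prime as a measure for descent

^-∣-cancel : ∀ {q} .{{_ : ℕ.NonZero q}} c → (∀ z → + q ∣ℤ c * z → + q ∣ℤ z) → ∀ m z → (+ q) ^ m ∣ℤ c * z → (+ q) ^ m ∣ℤ z
^-∣-cancel c cancel zero z _ = divides z (sym (ℤ.*-identityʳ z))
^-∣-cancel {q} c cancel (suc m) z (divides s eq) with cancel z (divides (s * (+ q) ^ m) (trans eq (id s (+ q) ((+ q) ^ m))))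
  where
  id : ∀ s q r → s * (q * r) ≡ s * r * q
  id = solve-∀
... | divides t refl with ^-∣-cancel c cancel m t (divides s (ℤ.*-cancelʳ-≡ _ _ (+ q) (trans (ℤ.*-assoc c t (+ q)) (trans eq (id s (+ q) ((+ q) ^ m))))))
  where
  id : ∀ s q r → s * (q * r) ≡ s * r * q
  id = solve-∀
...   | divides r refl = divides r (id r (+ q) ((+ q) ^ m))
  where
  id : ∀ s q r → s * r * q ≡ s * (q * r)
  id = solve-∀

^-∣-suc : ∀ q m {z w} → w ≡ q * z → q ^ m ∣ℤ z → q ^ suc m ∣ℤ w
^-∣-suc q m eq (divides k refl) = divides k (trans eq (id q k (q ^ m)))
  where
  id : ∀ q k r → q * (k * r) ≡ k * (q * r)
  id = solve-∀

-- Supplies the initial bound of each descent. The exponent |z| suffices because |z| < q^|z|; a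
-- strict bound on the power of q replaces a valuation.
^-∤ : ∀ q → 1 < q → ∀ {z} → z ≢ + 0 → ∃[ m ] ¬ (+ q) ^ m ∣ℤ z
^-∤ q 1<q {z} z≢0 = ∣ z ∣ , λ q^∣z →
  ℕ.>⇒∤ {{ℕ.≢-nonZero (z≢0 ∘ ℤ.∣i∣≡0⇒i≡0)}} (bound ∣ z ∣) (subst (_∣ ∣ z ∣) (abs-^ ∣ z ∣) (∣⇒∣ᵤ q^∣z))
  where
  abs-^ : ∀ m → ∣ (+ q) ^ m ∣ ≡ q ℕ.^ m
  abs-^ zero = refl
  abs-^ (suc m) = trans (ℤ.abs-* (+ q) ((+ q) ^ m)) (cong (q ℕ.*_) (abs-^ m))
  bound : ∀ m → m < q ℕ.^ m
  bound zero = s≤s z≤n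
  bound (suc m) = ℕ.≤-<-trans (bound m) (ℕ.m<m*n (q ℕ.^ m) q {{ℕ.>-nonZero (ℕ.≤-<-trans z≤n (bound m))}} 1<q
    |> subst (q ℕ.^ m <_) (ℕ.*-comm (q ℕ.^ m) q))

-- Triples with all entries prime to p

module Unit {p : ℕ} (p-prime : Prime p) (3<p : 3 < p) where

  P : ℤ → Set
  P x = + p ∣ℤ x

  P? : ∀ x → Dec (P x)
  P? x = + p ∣? x

  cancel : ∀ c .{{_ : ℕ.NonZero c}} → c < p → ∀ x → P (+ c * x) → P x
  cancel c c<p x r = either (prime-∣ℤ-* p-prime (+ c) x r) (λ p∣c → ⊥-elim (ℕ.>⇒∤ c<p (∣⇒∣ᵤ p∣c))) (λ r → r)

  half : ∀ x → P (+ 2 * x) → P x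
  half = cancel 2 (ℕ.<-trans (ℕ.n<1+n 2) 3<p)

  UnitTriple : ℤ → Set
  UnitTriple n = ∃[ a ] ∃[ b ] ∃[ c ] Rep₃ n a b c × ¬ P a × ¬ P b × ¬ P c

  ¬P-neg : ∀ {x} → ¬ P x → ¬ P (- x)
  ¬P-neg ¬Px = ¬Px ∘ neg-∣

  -- Modulo p, 3 k ≡ c, so k is prime to p and the image is (- 2 k, - 2 k, k).
  reflect-twoMultiples : ∀ {n a b c} → Rep₃ n a b c → P a → P b → ¬ P c → T (a + b + c) → UnitTriple n
  reflect-twoMultiples {n} {a} {b} {c} r Pa Pb ¬Pc (divides k eq) = go _ (third≡ a b k eq) r ¬Pc
    where
    go : ∀ c → c ≡ k * + 3 - a - b → Rep₃ n a b c → ¬ P c → UnitTriple n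
    go _ refl r ¬Pc = _ , _ , _ , reflect {k = k} r (solve (a ∷ b ∷ k ∷ [])) ,
      (λ s → ¬Pk (half k (lin₂ (+ 1) (- + 1) Pa s (solve (a ∷ k ∷ []))))) ,
      (λ s → ¬Pk (half k (lin₂ (+ 1) (- + 1) Pb s (solve (b ∷ k ∷ []))))) ,
      (λ s → ¬Pk (lin₃ (+ 1) (+ 1) (+ 1) s Pa Pb (solve (a ∷ b ∷ k ∷ []))))
      where
      ¬Pk : ¬ P k
      ¬Pk Pk = ¬Pc (lin₃ (+ 3) (- + 1) (- + 1) Pk Pa Pb (solve (a ∷ b ∷ k ∷ [])))

  -- The congruences under which the reflection of (a, b, c) with p ∣ a has an entry divisible by p.
  data Bad (b c : ℤ) : Set where
    b+c  : P (b + c) → Bad b c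
    b-2c : P (b - + 2 * c) → Bad b c
    c-2b : P (c - + 2 * b) → Bad b c

  -- Modulo p, three times the image is (- 2 (b + c), b - 2 c, c - 2 b).
  reflect-oneMultiple-P : ∀ {n a b c} → Rep₃ n a b c → P a → T (a + b + c) → UnitTriple n ⊎ Bad b c
  reflect-oneMultiple-P {n} {a} {b} {c} r Pa (divides k eq) = go _ (third≡ a b k eq) r
    where
    go : ∀ c → c ≡ k * + 3 - a - b → Rep₃ n a b c → UnitTriple n ⊎ Bad b c
    go c@_ refl r with P? (a - + 2 * k) | P? (b - + 2 * k) | P? (c - + 2 * k)
    ... | no p | no q | no s = inj₁ (_ , _ , _ , reflect {k = k} r (sum a b k) , p , q , s)
      where
      sum : ∀ a b k → a + b + (k * + 3 - a - b) ≡ k * + 3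
      sum = solve-∀
    ... | yes s | _ | _ = inj₂ (b+c (lin₂ (+ 3) (- + 1) (half k (lin₂ (+ 1) (- + 1) Pa s (id₁ a k))) Pa (id₂ a b k)))
      where
      id₁ : ∀ a k → + 2 * k ≡ + 1 * a + - + 1 * (a - + 2 * k)
      id₁ = solve-∀
      id₂ : ∀ a b k → b + (k * + 3 - a - b) ≡ + 3 * k + - + 1 * a
      id₂ = solve-∀
    ... | _ | yes s | _ = inj₂ (b-2c (lin₂ (+ 3) (+ 2) s Pa (id a b k)))
      where
      id : ∀ a b k → b - + 2 * (k * + 3 - a - b) ≡ + 3 * (b - + 2 * k) + + 2 * a
      id = solve-∀
    ... | _ | _ | yes s = inj₂ (c-2b (lin₂ (+ 3) (+ 2) s Pa (id a b k)))
      where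
      id : ∀ a b k → k * + 3 - a - b - + 2 * b ≡ + 3 * (k * + 3 - a - b - + 2 * k) + + 2 * a
      id = solve-∀

  -- If p = 5 and a² + b² + c² ≡ a ≡ 0 mod 5, then b ≡ ± 2c, and both (b, c) and (b, - c) can be bad.
  NonDegenerate : ℤ → Set
  NonDegenerate n = ¬ (P (+ 5) × P n)

  -- One condition for c and one for - c form two linear congruences in b and c. Their determinant
  -- is 1, 2 or 4 up to sign, which forces p to divide b or c, except when b ≡ 2 c or c ≡ 2 b meets
  -- its perpendicular counterpart: there it is 5, and then p divides 5 and n.
  bad-bad : ∀ {n a b c} → NonDegenerate n → Rep₃ n a b c → P a → ¬ P b → ¬ P c → Bad b c → Bad b (- c) → ⊥
  bad-bad {a = a} {b} {c} H (rep₃ refl) Pa ¬Pb ¬Pc = go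
    where
    five : ∀ {x} → ¬ P x → P (+ 5 * x) → P (+ 5)
    five {x} ¬Px r = either (prime-∣ℤ-* p-prime (+ 5) x r) (λ r → r) (λ r → ⊥-elim (¬Px r))
    go : Bad b c → Bad b (- c) → ⊥
    go (b+c r) (b+c s) = ¬Pb (half b (lin₂ (+ 1) (+ 1) r s (solve (b ∷ c ∷ []))))
    go (b+c r) (b-2c s) = ¬Pc (lin₂ (- + 1) (+ 1) r s (solve (b ∷ c ∷ [])))
    go (b+c r) (c-2b s) = ¬Pb (lin₂ (- + 1) (- + 1) r s (solve (b ∷ c ∷ [])))
    go (b-2c r) (b+c s) = ¬Pc (lin₂ (- + 1) (+ 1) r s (solve (b ∷ c ∷ [])))
    go (b-2c r) (b-2c s) = ¬Pb (half b (lin₂ (+ 1) (+ 1) r s (solve (b ∷ c ∷ []))))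
    go (b-2c r) (c-2b s) = H (five ¬Pc 5c , lin₃ a (b + + 2 * c) c Pa r 5c (solve (a ∷ b ∷ c ∷ [])))
      where
      5c : P (+ 5 * c)
      5c = lin₂ (- + 2) (- + 1) r s (solve (b ∷ c ∷ []))
    go (c-2b r) (b+c s) = ¬Pb (lin₂ (- + 1) (- + 1) r s (solve (b ∷ c ∷ [])))
    go (c-2b r) (b-2c s) = H (five ¬Pb 5b , lin₃ a (c + + 2 * b) b Pa r 5b (solve (a ∷ b ∷ c ∷ [])))
      where
      5b : P (+ 5 * b)
      5b = lin₂ (- + 2) (+ 1) r s (solve (b ∷ c ∷ []))
    go (c-2b r) (c-2b s) = ¬Pb (half b (half (+ 2 * b) (lin₂ (- + 1) (- + 1) r s (solve (b ∷ c ∷ [])))))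

  free : ∀ {n a b c} → NonDegenerate n → Rep₃ n a b c → P a → ¬ P b → ¬ P c → T (a + b) → T c → UnitTriple n
  free {n} {a} {b} {c} H r Pa ¬Pb ¬Pc T[a+b] Tc =
    either (reflect-oneMultiple-P r Pa (lin₂ (+ 1) (+ 1) T[a+b] Tc (solve (a ∷ b ∷ c ∷ [])))) (λ u → u) λ bad₊ →
    either (reflect-oneMultiple-P (rep₃-neg₃ r) Pa (lin₂ (+ 1) (- + 1) T[a+b] Tc (solve (a ∷ b ∷ c ∷ [])))) (λ u → u) λ bad₋ →
    ⊥-elim (bad-bad H r Pa ¬Pb ¬Pc bad₊ bad₋)

  free′ : ∀ {n a b c} → NonDegenerate n → Rep₃ n a b c → P a → ¬ P b → ¬ P c → ¬ T a → ¬ T b → T c → UnitTriple n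
  free′ {n} {a} {b} {c} H r Pa ¬Pb ¬Pc ¬Ta ¬Tb Tc = either (T± ¬Ta ¬Tb)
    (λ t → free H r Pa ¬Pb ¬Pc t Tc)
    (λ t → free H (rep₃-swap₂₃ (rep₃-neg₃ (rep₃-swap₂₃ r))) Pa (¬P-neg ¬Pb) ¬Pc t Tc)

  -- The position of the multiple of p among the reflected coordinates, and its 3-adic size.
  data Located (m : ℕ) (x y z : ℤ) : Set where
    at₁ : P x → ¬ P y → ¬ P z → ¬ (+ 3) ^ m ∣ℤ x → Located m x y z
    at₂ : ¬ P x → P y → ¬ P z → ¬ (+ 3) ^ m ∣ℤ y → Located m x y z
    at₃ : ¬ P x → ¬ P y → P z → ¬ (+ 3) ^ m ∣ℤ z → Located m x y z

  T-half : ∀ z → T (+ 2 * z) → T z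
  T-half z r = lin₂ (- + 1) (+ 1) r (T-triple z) (solve (z ∷ []))

  T-quarter : ∀ z → T (+ 4 * z) → T z
  T-quarter z r = lin₂ (+ 1) (- + 1) r (T-triple z) (solve (z ∷ []))

  moved : ∀ {b c} → Bad b c → ℤ → ℤ → ℤ
  moved         (b+c _)  a k = a - + 2 * k
  moved {b = b} (b-2c _) a k = b - + 2 * k
  moved {c = c} (c-2b _) a k = c - + 2 * k

  -- Changing the sign of a changes the reflected multiple of p by 2a/3 or 4a/3,
  -- so for one of the signs it is less divisible by 3 than a.
  moved-small : ∀ m {a b c} k k′ (bad : Bad b c) → a + b + c ≡ k * + 3 → - a + b + c ≡ k′ * + 3 →
    (+ 3) ^ m ∣ℤ moved bad a k → (+ 3) ^ m ∣ℤ moved bad (- a) k′ → (+ 3) ^ suc m ∣ℤ a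
  moved-small m {a} {b} {c} k k′ bad eq eq′ r s = go bad r s
    where
    2a : ∀ {z} → z ≡ + 6 * a - + 2 * (k * + 3) + + 2 * (k′ * + 3) → z ≡ + 2 * a
    2a e = trans e (trans (cong₂ (λ x y → + 6 * a - + 2 * x + + 2 * y) (sym eq) (sym eq′)) (solve (a ∷ b ∷ c ∷ [])))
    4a : ∀ {z} → z ≡ + 2 * (k * + 3) - + 2 * (k′ * + 3) → z ≡ + 4 * a
    4a e = trans e (trans (cong₂ (λ x y → + 2 * x - + 2 * y) (sym eq) (sym eq′)) (solve (a ∷ b ∷ c ∷ [])))
    id₁ : ∀ a k k′ → + 3 * ((a - + 2 * k) - (- a - + 2 * k′)) ≡ + 6 * a - + 2 * (k * + 3) + + 2 * (k′ * + 3)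
    id₁ = solve-∀
    id₂ : ∀ b k k′ → + 3 * ((b - + 2 * k′) - (b - + 2 * k)) ≡ + 2 * (k * + 3) - + 2 * (k′ * + 3)
    id₂ = solve-∀
    go : (bad : Bad b c) → (+ 3) ^ m ∣ℤ moved bad a k → (+ 3) ^ m ∣ℤ moved bad (- a) k′ → (+ 3) ^ suc m ∣ℤ a
    go (b+c _) r s = ^-∣-cancel (+ 2) T-half (suc m) a (^-∣-suc (+ 3) m (sym (2a (id₁ a k k′))) (∣m∣n⇒∣m-n r s))
    go (b-2c _) r s = ^-∣-cancel (+ 4) T-quarter (suc m) a (^-∣-suc (+ 3) m (sym (4a (id₂ b k k′))) (∣m∣n⇒∣m-n s r))
    go (c-2b _) r s = ^-∣-cancel (+ 4) T-quarter (suc m) a (^-∣-suc (+ 3) m (sym (4a (id₂ c k k′))) (∣m∣n⇒∣m-n s r))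

  -- If b ≡ - c, then p divides k and the image is (0, b, c) modulo p. Otherwise k is prime to p and
  -- the image is (- 2 k, 0, - k) or (- 2 k, - k, 0).
  locate : ∀ m {a b c} k (bad : Bad b c) → P a → ¬ P b → ¬ P c → a + b + c ≡ k * + 3 →
    ¬ (+ 3) ^ m ∣ℤ moved bad a k → Located m (a - + 2 * k) (b - + 2 * k) (c - + 2 * k)
  locate m {a} {b} {c} k bad Pa ¬Pb ¬Pc eq small = go c (third≡ a b k eq) ¬Pc bad small
    where
    cancel₃ : ∀ x → P (+ 3 * x) → P x
    cancel₃ = cancel 3 3<p
    go : ∀ c → c ≡ k * + 3 - a - b → ¬ P c → (bad : Bad b c) → ¬ (+ 3) ^ m ∣ℤ moved bad a k →
      Located m (a - + 2 * k) (b - + 2 * k) (c - + 2 * k)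
    go c refl ¬Pc (b+c s) = at₁ Pa′
      (λ r → ¬Pb (lin₂ (+ 1) (+ 2) r Pk (solve (b ∷ k ∷ []))))
      (λ r → ¬Pc (lin₂ (+ 1) (+ 2) r Pk (solve (a ∷ b ∷ k ∷ []))))
      where
      Pk : P k
      Pk = cancel₃ k (lin₂ (+ 1) (+ 1) s Pa (solve (a ∷ b ∷ k ∷ [])))
      Pa′ : P (a - + 2 * k)
      Pa′ = lin₂ (+ 1) (- + 2) Pa Pk (solve (a ∷ k ∷ []))
    go c refl ¬Pc (b-2c s) = at₂
      (λ r → ¬Pk (half k (lin₂ (+ 1) (- + 1) Pa r (solve (a ∷ k ∷ [])))))
      Pb′
      (λ r → ¬Pk (lin₃ (- + 1) (- + 1) (- + 1) r Pa Pb′ (solve (a ∷ b ∷ k ∷ []))))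
      where
      Pb′ : P (b - + 2 * k)
      Pb′ = cancel₃ (b - + 2 * k) (lin₂ (+ 1) (- + 2) s Pa (solve (a ∷ b ∷ k ∷ [])))
      ¬Pk : ¬ P k
      ¬Pk Pk = ¬Pb (lin₂ (+ 1) (+ 2) Pb′ Pk (solve (b ∷ k ∷ [])))
    go c refl ¬Pc (c-2b s) = at₃
      (λ r → ¬Pk (half k (lin₂ (+ 1) (- + 1) Pa r (solve (a ∷ k ∷ [])))))
      (λ r → ¬Pk (lin₃ (- + 1) (- + 1) (- + 1) r Pa Pc′ (solve (a ∷ b ∷ k ∷ []))))
      Pc′
      where
      Pc′ : P (k * + 3 - a - b - + 2 * k)
      Pc′ = cancel₃ (k * + 3 - a - b - + 2 * k) (lin₂ (+ 1) (- + 2) s Pa (solve (a ∷ b ∷ k ∷ [])))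
      ¬Pk : ¬ P k
      ¬Pk Pk = ¬Pc (lin₂ (+ 1) (+ 2) Pc′ Pk (solve (a ∷ b ∷ k ∷ [])))

  mutual
    reduce : ∀ m {n a b c} → NonDegenerate n → Rep₃ n a b c → OneMultiple a b c →
      P a → ¬ P b → ¬ P c → ¬ (+ 3) ^ m ∣ℤ a → UnitTriple n
    reduce m H r (second ¬Ta Tb ¬Tc) Pa ¬Pb ¬Pc small = free′ H (rep₃-swap₂₃ r) Pa ¬Pc ¬Pb ¬Ta ¬Tc Tb
    reduce m H r (third ¬Ta ¬Tb Tc) Pa ¬Pb ¬Pc small = free′ H r Pa ¬Pb ¬Pc ¬Ta ¬Tb Tc
    -- The bound 0 is absurd because 3⁰ = 1 divides everything, so the descent has to end in one of
    -- the two cases above or in a successful reflection.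
    reduce zero {a = a} H r _ Pa ¬Pb ¬Pc small = ⊥-elim (small (divides a (sym (ℤ.*-identityʳ a))))
    reduce (suc m) {b = b} {c} H r (first Ta ¬Tb ¬Tc) Pa ¬Pb ¬Pc small = either (T± ¬Tb ¬Tc)
      (λ t → reduce-step m H r Ta ¬Tb ¬Tc t Pa ¬Pb ¬Pc small)
      (λ t → reduce-step m H (rep₃-neg₃ r) Ta ¬Tb (¬Tc ∘ neg-∣) t Pa ¬Pb (¬P-neg ¬Pc) small)

    reduce-step : ∀ m {n a b c} → NonDegenerate n → Rep₃ n a b c → T a → ¬ T b → ¬ T c → T (b + c) →
      P a → ¬ P b → ¬ P c → ¬ (+ 3) ^ suc m ∣ℤ a → UnitTriple n
    reduce-step m {n} {a} {b} {c} H r Ta ¬Tb ¬Tc Tbc Pa ¬Pb ¬Pc small =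
      either (reflect-oneMultiple-P r Pa (divides k eq)) (λ u → u) λ bad → choose bad ((+ 3) ^ m ∣? moved bad a k)
      where
      sum₊ : T (a + b + c)
      sum₊ = lin₂ (+ 1) (+ 1) Ta Tbc (solve (a ∷ b ∷ c ∷ []))
      sum₋ : T (- a + b + c)
      sum₋ = lin₂ (- + 1) (+ 1) Ta Tbc (solve (a ∷ b ∷ c ∷ []))
      k = _∣ℤ_.quotient sum₊
      eq = _∣ℤ_.equality sum₊
      k′ = _∣ℤ_.quotient sum₋
      eq′ = _∣ℤ_.equality sum₋
      neg : ∀ {m x} → m ∣ℤ x → m ∣ℤ - x
      neg {x = x} r = lin₁ (- + 1) r (solve (x ∷ []))
      choose : (bad : Bad b c) → Dec ((+ 3) ^ m ∣ℤ moved bad a k) → UnitTriple n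
      choose bad (no small′) = reduce-located m H (reflect r eq) (reflect-oneMultiple {k = k} eq Ta ¬Tb ¬Tc)
        (locate m k bad Pa ¬Pb ¬Pc eq small′)
      choose bad (yes big) = reduce-located m H (reflect (rep₃-neg₁ r) eq′) (reflect-oneMultiple {k = k′} eq′ (neg Ta) ¬Tb ¬Tc)
        (locate m k′ bad (neg Pa) ¬Pb ¬Pc eq′ λ big′ → small (moved-small m k k′ bad eq eq′ big big′))

    reduce-located : ∀ m {n a b c} → NonDegenerate n → Rep₃ n a b c → OneMultiple a b c → Located m a b c → UnitTriple n
    reduce-located m H r o (at₁ Pa ¬Pb ¬Pc small) = reduce m H r o Pa ¬Pb ¬Pc small
    reduce-located m H r o (at₂ ¬Pa Pb ¬Pc small) = reduce m H (rep₃-swap₁₂ r) (oneMultiple-swap₁₂ o) Pb ¬Pa ¬Pc small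
    reduce-located m H r o (at₃ ¬Pa ¬Pb Pc small) =
      reduce m H (rep₃-swap₁₂ (rep₃-swap₂₃ r)) (oneMultiple-swap₁₂ (oneMultiple-swap₂₃ o)) Pc ¬Pa ¬Pb small

-- Residues modulo 3 and the choice of a triple

-- The triples in which some signs make the sum divisible by 3 and some entry is a multiple of 3, so
-- that its sign stays free. Three entries prime to 3 also admit suitable signs, but only one choice
-- up to a global sign.
data Reflectable (a b c : ℤ) : Set where
  one : OneMultiple a b c → Reflectable a b c
  all : T a → T b → T c → Reflectable a b c

reflectable-swap₁₂ : ∀ {a b c} → Reflectable a b c → Reflectable b a c
reflectable-swap₁₂ (one o) = one (oneMultiple-swap₁₂ o)
reflectable-swap₁₂ (all x y z) = all y x z

reflectable-swap₂₃ : ∀ {a b c} → Reflectable a b c → Reflectable a c b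
reflectable-swap₂₃ (one o) = one (oneMultiple-swap₂₃ o)
reflectable-swap₂₃ (all x y z) = all x z y

rep-swap₁₂ : ∀ {n a b c d} → Rep n a b c d → Rep n b a c d
rep-swap₁₂ {a = a} {b} {c} {d} (rep refl) = rep (id a b c d)
  where
  id : ∀ a b c d → b * b + a * a + c * c + d * d ≡ a * a + b * b + c * c + d * d
  id = solve-∀

rep-swap₂₃ : ∀ {n a b c d} → Rep n a b c d → Rep n a c b d
rep-swap₂₃ {a = a} {b} {c} {d} (rep refl) = rep (id a b c d)
  where
  id : ∀ a b c d → a * a + c * c + b * b + d * d ≡ a * a + b * b + c * c + d * d
  id = solve-∀

rep-swap₃₄ : ∀ {n a b c d} → Rep n a b c d → Rep n a b d c
rep-swap₃₄ {a = a} {b} {c} {d} (rep refl) = rep (id a b c d)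
  where
  id : ∀ a b c d → a * a + b * b + d * d + c * c ≡ a * a + b * b + c * c + d * d
  id = solve-∀

rep₃⇒rep : ∀ {n a b c d} → Rep₃ (n - d * d) a b c → Rep n a b c d
rep₃⇒rep {n} {d = d} (rep₃ s) = rep (trans (cong (_+ d * d) s) (id n d))
  where
  id : ∀ n d → n - d * d + d * d ≡ n
  id = solve-∀

rep⇒rep₃ : ∀ {n a b c d} → Rep n a b c d → Rep₃ (n - d * d) a b c
rep⇒rep₃ {a = a} {b} {c} {d} (rep refl) = rep₃ (id a b c d)
  where
  id : ∀ a b c d → a * a + b * b + c * c ≡ a * a + b * b + c * c + d * d - d * d
  id = solve-∀

-- u stands for an entry prime to 3, z for a multiple of 3.
data Shape (a b c d : ℤ) : Set where
  reflectable : Reflectable a b c → Shape a b c d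
  uuuz : ¬ T a → ¬ T b → ¬ T c → T d → Shape a b c d
  uzzu : ¬ T a → T b → T c → ¬ T d → Shape a b c d
  zuzu : T a → ¬ T b → T c → ¬ T d → Shape a b c d
  zzuu : T a → T b → ¬ T c → ¬ T d → Shape a b c d

oneUnit : ∀ {n a b c d} → ¬ T (n - + 1) → Rep n a b c d → ¬ T a → T b → T c → T d → ⊥
oneUnit {a = a} {b} {c} {d} n≢1 (rep refl) ¬Ta Tb Tc Td = n≢1 (lin₄ (+ 1) b c d (T-square-1 ¬Ta) Tb Tc Td (id a b c d))
  where
  id : ∀ a b c d → a * a + b * b + c * c + d * d - + 1 ≡ + 1 * (a * a - + 1) + b * b + c * c + d * d
  id = solve-∀

fourUnits : ∀ {n a b c d} → ¬ T (n - + 1) → Rep n a b c d → ¬ T a → ¬ T b → ¬ T c → ¬ T d → ⊥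
fourUnits {a = a} {b} {c} {d} n≢1 (rep refl) ¬Ta ¬Tb ¬Tc ¬Td = n≢1 (subst T (sym (id a b c d)) (∣m∣n⇒∣m+n
    (lin₄ (+ 1) (+ 1) (+ 1) (+ 1) (T-square-1 ¬Ta) (T-square-1 ¬Tb) (T-square-1 ¬Tc) (T-square-1 ¬Td) refl) (T-triple (+ 1))))
  where
  id : ∀ a b c d → a * a + b * b + c * c + d * d - + 1 ≡
    + 1 * (a * a - + 1) + + 1 * (b * b - + 1) + + 1 * (c * c - + 1) + + 1 * (d * d - + 1) + + 3 * + 1
  id = solve-∀

-- The number of entries prime to 3 is congruent to n modulo 3, so it is neither 1 nor 4.
shape : ∀ {n a b c d} → ¬ T (n - + 1) → Rep n a b c d → Shape a b c d
shape {n} {a} {b} {c} {d} n≢1 r with + 3 ∣? a | + 3 ∣? b | + 3 ∣? c | + 3 ∣? d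
... | yes x | yes y | yes z | _     = reflectable (all x y z)
... | yes x | no  y | no  z | _     = reflectable (one (first x y z))
... | no  x | yes y | no  z | _     = reflectable (one (second x y z))
... | no  x | no  y | yes z | _     = reflectable (one (third x y z))
... | no  x | no  y | no  z | yes w = uuuz x y z w
... | no  x | yes y | yes z | no  w = uzzu x y z w
... | yes x | no  y | yes z | no  w = zuzu x y z w
... | yes x | yes y | no  z | no  w = zzuu x y z w
... | no  x | yes y | yes z | yes w = ⊥-elim (oneUnit n≢1 r x y z w)
... | yes x | no  y | yes z | yes w = ⊥-elim (oneUnit n≢1 (rep-swap₁₂ r) y x z w)
... | yes x | yes y | no  z | yes w = ⊥-elim (oneUnit n≢1 (rep-swap₁₂ (rep-swap₂₃ r)) z x y w)
... | no  x | no  y | no  z | no  w = ⊥-elim (fourUnits n≢1 r x y z w)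

-- A multiple of p has to lie in the reflected triple. Each alternative therefore offers a triple
-- containing a, and the first two contain b as well. Only when 3 divides a and b but neither c nor
-- d can no triple serve both, and then a and b get one each.
choose : ∀ {n a b c d} → ¬ T (n - + 1) → Rep n a b c d →
  Reflectable a b c ⊎ Reflectable a b d ⊎ (Reflectable a c d × Reflectable b c d)
choose n≢1 r with shape n≢1 r
... | reflectable o = inj₁ o
... | uuuz x y _ w = inj₂ (inj₁ (one (third x y w)))
... | uzzu x y _ w = inj₂ (inj₁ (one (second x y w)))
... | zuzu x y _ w = inj₂ (inj₁ (one (first x y w)))
... | zzuu x y z w = inj₂ (inj₂ (one (first x z w) , one (first y z w)))

-- A property stable under adjacent transpositions may be proved with the entries in `Q` in front,
-- which leaves only their number.
module Sort {Q : ℤ → Set} (Q? : ∀ x → Dec (Q x)) (C : ℤ → ℤ → ℤ → ℤ → Set)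
  (s₁₂ : ∀ {a b c d} → C b a c d → C a b c d)
  (s₂₃ : ∀ {a b c d} → C a c b d → C a b c d)
  (s₃₄ : ∀ {a b c d} → C a b d c → C a b c d)
  (f₀ : ∀ {a b c d} → ¬ Q a → ¬ Q b → ¬ Q c → ¬ Q d → C a b c d)
  (f₁ : ∀ {a b c d} → Q a → ¬ Q b → ¬ Q c → ¬ Q d → C a b c d)
  (f₂ : ∀ {a b c d} → Q a → Q b → ¬ Q c → ¬ Q d → C a b c d)
  (f₃ : ∀ {a b c d} → Q a → Q b → Q c → ¬ Q d → C a b c d)
  (f₄ : ∀ {a b c d} → Q a → Q b → Q c → Q d → C a b c d) where

  sort : ∀ a b c d → C a b c d
  sort a b c d with Q? a | Q? b | Q? c | Q? d
  ... | yes x | yes y | yes z | yes w = f₄ x y z w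
  ... | yes x | yes y | yes z | no  w = f₃ x y z w
  ... | yes x | yes y | no  z | yes w = s₃₄ (f₃ x y w z)
  ... | yes x | no  y | yes z | yes w = s₂₃ (s₃₄ (f₃ x z w y))
  ... | no  x | yes y | yes z | yes w = s₁₂ (s₂₃ (s₃₄ (f₃ y z w x)))
  ... | yes x | yes y | no  z | no  w = f₂ x y z w
  ... | yes x | no  y | yes z | no  w = s₂₃ (f₂ x z y w)
  ... | yes x | no  y | no  z | yes w = s₃₄ (s₂₃ (f₂ x w y z))
  ... | no  x | yes y | yes z | no  w = s₁₂ (s₂₃ (f₂ y z x w))
  ... | no  x | yes y | no  z | yes w = s₃₄ (s₁₂ (s₂₃ (f₂ y w x z)))
  ... | no  x | no  y | yes z | yes w = s₂₃ (s₃₄ (s₁₂ (s₂₃ (f₂ z w x y))))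
  ... | yes x | no  y | no  z | no  w = f₁ x y z w
  ... | no  x | yes y | no  z | no  w = s₁₂ (f₁ y x z w)
  ... | no  x | no  y | yes z | no  w = s₂₃ (s₁₂ (f₁ z x y w))
  ... | no  x | no  y | no  z | yes w = s₃₄ (s₂₃ (s₁₂ (f₁ w x y z)))
  ... | no  x | no  y | no  z | no  w = f₀ x y z w

-- Repair of four squares, by the number of multiples of p

module Good {p : ℕ} (p-prime : Prime p) (3<p : 3 < p) where
  open Unit p-prime 3<p

  Admissible : ℤ → Set
  Admissible x = x ≡ + 0 ⊎ ¬ P x

  Good : ℤ → Set
  Good n = ∃[ a ] ∃[ b ] ∃[ c ] ∃[ d ] Rep n a b c d × Admissible a × Admissible b × Admissible c × Admissible d

  unitTriple⇒good : ∀ {n d} → Admissible d → UnitTriple (n - d * d) → Good n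
  unitTriple⇒good ok (a , b , c , r , ¬Pa , ¬Pb , ¬Pc) = a , b , c , _ , rep₃⇒rep r , inj₂ ¬Pa , inj₂ ¬Pb , inj₂ ¬Pc , ok

  unit-oneMultiple : ∀ {n a b c} → NonDegenerate n → Reflectable a b c → Rep₃ n a b c →
    P a → a ≢ + 0 → ¬ P b → ¬ P c → UnitTriple n
  unit-oneMultiple H (one o) r Pa a≢0 ¬Pb ¬Pc =
    let m , small = ^-∤ 3 (s≤s (s≤s z≤n)) a≢0 in reduce m H r o Pa ¬Pb ¬Pc small
  unit-oneMultiple H (all Ta Tb Tc) r Pa a≢0 ¬Pb ¬Pc = free H r Pa ¬Pb ¬Pc (∣m∣n⇒∣m+n Ta Tb) Tc

  unit-twoMultiples : ∀ {n a b c} → Reflectable a b c → Rep₃ n a b c → P a → P b → ¬ P c → UnitTriple n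
  unit-twoMultiples {n} {a} {b} {c} o r Pa Pb ¬Pc = go o
    where
    r₂ : Rep₃ n a (- b) c
    r₂ = rep₃-swap₂₃ (rep₃-neg₃ (rep₃-swap₂₃ r))
    neg : P b → P (- b)
    neg Pb = lin₁ (- + 1) Pb (solve (b ∷ []))
    go : Reflectable a b c → UnitTriple n
    go (all Ta Tb Tc) = reflect-twoMultiples r Pa Pb ¬Pc (∣m∣n⇒∣m+n (∣m∣n⇒∣m+n Ta Tb) Tc)
    go (one (first Ta ¬Tb ¬Tc)) = either (T± ¬Tb ¬Tc)
      (λ t → reflect-twoMultiples r Pa Pb ¬Pc (lin₂ (+ 1) (+ 1) Ta t (solve (a ∷ b ∷ c ∷ []))))
      (λ t → reflect-twoMultiples (rep₃-neg₃ r) Pa Pb (¬P-neg ¬Pc) (lin₂ (+ 1) (+ 1) Ta t (solve (a ∷ b ∷ c ∷ []))))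
    go (one (second ¬Ta Tb ¬Tc)) = either (T± ¬Ta ¬Tc)
      (λ t → reflect-twoMultiples r Pa Pb ¬Pc (lin₂ (+ 1) (+ 1) Tb t (solve (a ∷ b ∷ c ∷ []))))
      (λ t → reflect-twoMultiples (rep₃-neg₃ r) Pa Pb (¬P-neg ¬Pc) (lin₂ (+ 1) (+ 1) Tb t (solve (a ∷ b ∷ c ∷ []))))
    go (one (third ¬Ta ¬Tb Tc)) = either (T± ¬Ta ¬Tb)
      (λ t → reflect-twoMultiples r Pa Pb ¬Pc (lin₂ (+ 1) (+ 1) t Tc (solve (a ∷ b ∷ c ∷ []))))
      (λ t → reflect-twoMultiples r₂ Pa (neg Pb) ¬Pc (lin₂ (+ 1) (+ 1) t Tc (solve (a ∷ b ∷ c ∷ []))))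

  -- Reflecting two multiples of p together with a unit succeeds in every case, degenerate or not.
  -- The reduction to a single multiple is thus shared with the case p = 5, where only `good₁`
  -- differs.
  module Multiples {n : ℤ} (n≢1 : ¬ T (n - + 1))
    (good₁ : ∀ {a b c d} → P a → ¬ P b → ¬ P c → ¬ P d → Rep n a b c d → Good n) where

    good₁′ : ∀ {d} → P d → UnitTriple (n - d * d) → Good n
    good₁′ Pd (_ , _ , _ , r , ¬Pa , ¬Pb , ¬Pc) = good₁ Pd ¬Pa ¬Pb ¬Pc (rep-swap₁₂ (rep-swap₂₃ (rep-swap₃₄ (rep₃⇒rep r))))

    good₃ : ∀ {a b c d} → P a → P b → P c → ¬ P d → Rep n a b c d → Good n
    good₃ Pa Pb Pc ¬Pd r with choose n≢1 (rep-swap₁₂ (rep-swap₂₃ (rep-swap₃₄ r)))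
    ... | inj₁ dab = good₁′ Pc (unit-twoMultiples (reflectable-swap₂₃ (reflectable-swap₁₂ dab)) (rep⇒rep₃ (rep-swap₃₄ r)) Pa Pb ¬Pd)
    ... | inj₂ (inj₁ dac) = good₁′ Pb (unit-twoMultiples (reflectable-swap₂₃ (reflectable-swap₁₂ dac)) (rep⇒rep₃ (rep-swap₃₄ (rep-swap₂₃ r))) Pa Pc ¬Pd)
    ... | inj₂ (inj₂ (dbc , _)) = good₁′ Pa (unit-twoMultiples (reflectable-swap₂₃ (reflectable-swap₁₂ dbc)) (rep⇒rep₃ (rep-swap₃₄ (rep-swap₂₃ (rep-swap₁₂ r)))) Pb Pc ¬Pd)

  module Generic {n : ℤ} (¬Pn : ¬ P n) (n≢1 : ¬ T (n - + 1)) (H : ∀ d → NonDegenerate (n - d * d)) where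

    good₁ : ∀ {a b c d} → P a → ¬ P b → ¬ P c → ¬ P d → Rep n a b c d → Good n
    good₁ {a} {b} {c} {d} Pa ¬Pb ¬Pc ¬Pd r with a ℤ.≟ + 0
    ... | yes a≡0 = a , b , c , d , r , inj₁ a≡0 , inj₂ ¬Pb , inj₂ ¬Pc , inj₂ ¬Pd
    ... | no a≢0 with choose n≢1 r
    ...   | inj₁ abc = unitTriple⇒good (inj₂ ¬Pd) (unit-oneMultiple (H d) abc (rep⇒rep₃ r) Pa a≢0 ¬Pb ¬Pc)
    ...   | inj₂ (inj₁ abd) = unitTriple⇒good (inj₂ ¬Pc) (unit-oneMultiple (H c) abd (rep⇒rep₃ (rep-swap₃₄ r)) Pa a≢0 ¬Pb ¬Pd)
    ...   | inj₂ (inj₂ (acd , _)) = unitTriple⇒good (inj₂ ¬Pb)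
      (unit-oneMultiple (H b) acd (rep⇒rep₃ (rep-swap₃₄ (rep-swap₂₃ r))) Pa a≢0 ¬Pc ¬Pd)

    open Multiples n≢1 good₁

    good₂ : ∀ {a b c d} → P a → P b → ¬ P c → ¬ P d → Rep n a b c d → Good n
    good₂ {a} {b} {c} {d} Pa Pb ¬Pc ¬Pd r with choose n≢1 r
    ... | inj₁ abc = unitTriple⇒good (inj₂ ¬Pd) (unit-twoMultiples abc (rep⇒rep₃ r) Pa Pb ¬Pc)
    ... | inj₂ (inj₁ abd) = unitTriple⇒good (inj₂ ¬Pc) (unit-twoMultiples abd (rep⇒rep₃ (rep-swap₃₄ r)) Pa Pb ¬Pd)
    -- No available triple contains both multiples of p. If a ≠ 0, the triple (a, c, d) is repaired
    -- and b is left to `good₁`; if a = 0, it may stay and (b, c, d) is repaired.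
    ... | inj₂ (inj₂ (acd , bcd)) with a ℤ.≟ + 0 | b ℤ.≟ + 0
    ...   | yes a≡0 | yes b≡0 = a , b , c , d , r , inj₁ a≡0 , inj₁ b≡0 , inj₂ ¬Pc , inj₂ ¬Pd
    ...   | yes a≡0 | no b≢0 = unitTriple⇒good (inj₁ a≡0)
      (unit-oneMultiple (H a) bcd (rep⇒rep₃ (rep-swap₃₄ (rep-swap₂₃ (rep-swap₁₂ r)))) Pb b≢0 ¬Pc ¬Pd)
    ...   | no a≢0 | _ = good₁′ Pb (unit-oneMultiple (H b) acd (rep⇒rep₃ (rep-swap₃₄ (rep-swap₂₃ r))) Pa a≢0 ¬Pc ¬Pd)

    good₄ : ∀ {a b c d} → P a → P b → P c → P d → Rep n a b c d → Good n
    good₄ {a} {b} {c} {d} Pa Pb Pc Pd (rep s) = ⊥-elim (¬Pn (lin₄ a b c d Pa Pb Pc Pd (sym s)))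

    good : ∀ {a b c d} → Rep n a b c d → Good n
    good = Sort.sort P? (λ a b c d → Rep n a b c d → Good n) (_∘ rep-swap₁₂) (_∘ rep-swap₂₃) (_∘ rep-swap₃₄)
      (λ ¬Pa ¬Pb ¬Pc ¬Pd r → _ , _ , _ , _ , r , inj₂ ¬Pa , inj₂ ¬Pb , inj₂ ¬Pc , inj₂ ¬Pd) good₁ good₂ good₃ good₄ _ _ _ _

-- The case p = 5, n ≡ ± 1 mod 5

F : ℤ → Set
F x = + 5 ∣ℤ x

F-quintuple : ∀ x → F (+ 5 * x)
F-quintuple x = divides x (ℤ.*-comm (+ 5) x)

F-half : ∀ x → F (+ 2 * x) → F x
F-half x r = lin₂ (- + 2) (+ 1) r (F-quintuple x) (solve (x ∷ []))

data Mod5 (x : ℤ) : Set where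
  zero : F x → Mod5 x
  ±1 : F (x - + 1) ⊎ F (x + + 1) → Mod5 x
  ±2 : F (x - + 2) ⊎ F (x + + 2) → Mod5 x

mod5 : ∀ x → Mod5 x
mod5 x = go (x ℤ.%ℕ 5) (x ℤ./ℕ 5) (ℤ.a≡a%ℕn+[a/ℕn]*n x 5) (ℤ.n%ℕd<d x 5)
  where
  id₁ : ∀ q → + 1 + q * + 5 - + 1 ≡ q * + 5
  id₁ = solve-∀
  id₂ : ∀ q → + 2 + q * + 5 - + 2 ≡ q * + 5
  id₂ = solve-∀
  id₃ : ∀ q → + 3 + q * + 5 + + 2 ≡ (q + + 1) * + 5
  id₃ = solve-∀
  id₄ : ∀ q → + 4 + q * + 5 + + 1 ≡ (q + + 1) * + 5
  id₄ = solve-∀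
  go : ∀ r q → x ≡ + r + q * + 5 → r < 5 → Mod5 x
  go 0 q eq _ = zero (divides q (trans eq (ℤ.+-identityˡ _)))
  go 1 q eq _ = ±1 (inj₁ (divides q (trans (cong (_- + 1) eq) (id₁ q))))
  go 2 q eq _ = ±2 (inj₁ (divides q (trans (cong (_- + 2) eq) (id₂ q))))
  go 3 q eq _ = ±2 (inj₂ (divides (q + + 1) (trans (cong (_+ + 2) eq) (id₃ q))))
  go 4 q eq _ = ±1 (inj₂ (divides (q + + 1) (trans (cong (_+ + 1) eq) (id₄ q))))
  go (suc (suc (suc (suc (suc _))))) _ _ (s≤s (s≤s (s≤s (s≤s (s≤s ())))))

F-square : ∀ {x} → ¬ F x → F (x * x - + 1) ⊎ F (x * x + + 1)
F-square {x} ¬Fx = go (mod5 x)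
  where
  F5 : F (+ 5)
  F5 = ∣-refl
  go : Mod5 x → F (x * x - + 1) ⊎ F (x * x + + 1)
  go (zero r) = ⊥-elim (¬Fx r)
  go (±1 (inj₁ r)) = inj₁ (lin₁ (x + + 1) r (solve (x ∷ [])))
  go (±1 (inj₂ r)) = inj₁ (lin₁ (x - + 1) r (solve (x ∷ [])))
  go (±2 (inj₁ r)) = inj₂ (lin₂ (x + + 2) (+ 1) r F5 (solve (x ∷ [])))
  go (±2 (inj₂ r)) = inj₂ (lin₂ (x - + 2) (+ 1) r F5 (solve (x ∷ [])))

-- The squares modulo 5 are 0 and ± 1. Each case would make 5 divide the difference of such a square
-- and ± 2.
nonDegenerate-±2 : ∀ n → F (n - + 2) ⊎ F (n + + 2) → ∀ d → ¬ F (n - d * d)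
nonDegenerate-±2 n e d s = go e (mod5 d)
  where
  go : F (n - + 2) ⊎ F (n + + 2) → Mod5 d → ⊥
  go (inj₁ r) (zero t) = from-no (+ 5 ∣? + 2) (lin₃ (+ 1) (- + 1) d s r t (solve (n ∷ d ∷ [])))
  go (inj₂ r) (zero t) = from-no (+ 5 ∣? - + 2) (lin₃ (+ 1) (- + 1) d s r t (solve (n ∷ d ∷ [])))
  go (inj₁ r) (±1 (inj₁ t)) = from-no (+ 5 ∣? + 1) (lin₃ (+ 1) (- + 1) (d + + 1) s r t (solve (n ∷ d ∷ [])))
  go (inj₁ r) (±1 (inj₂ t)) = from-no (+ 5 ∣? + 1) (lin₃ (+ 1) (- + 1) (d - + 1) s r t (solve (n ∷ d ∷ [])))
  go (inj₂ r) (±1 (inj₁ t)) = from-no (+ 5 ∣? - + 3) (lin₃ (+ 1) (- + 1) (d + + 1) s r t (solve (n ∷ d ∷ [])))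
  go (inj₂ r) (±1 (inj₂ t)) = from-no (+ 5 ∣? - + 3) (lin₃ (+ 1) (- + 1) (d - + 1) s r t (solve (n ∷ d ∷ [])))
  go (inj₁ r) (±2 (inj₁ t)) = from-no (+ 5 ∣? - + 2) (lin₃ (+ 1) (- + 1) (d + + 2) s r t (solve (n ∷ d ∷ [])))
  go (inj₁ r) (±2 (inj₂ t)) = from-no (+ 5 ∣? - + 2) (lin₃ (+ 1) (- + 1) (d - + 2) s r t (solve (n ∷ d ∷ [])))
  go (inj₂ r) (±2 (inj₁ t)) = from-no (+ 5 ∣? - + 6) (lin₃ (+ 1) (- + 1) (d + + 2) s r t (solve (n ∷ d ∷ [])))
  go (inj₂ r) (±2 (inj₂ t)) = from-no (+ 5 ∣? - + 6) (lin₃ (+ 1) (- + 1) (d - + 2) s r t (solve (n ∷ d ∷ [])))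

≡⇒∣ : ∀ {m x y} → x ≡ y → m ∣ℤ x - y
≡⇒∣ {x = x} refl = divides (+ 0) (ℤ.+-inverseʳ x)

module Criterion {p : ℕ} (p-prime : Prime p) (3<p : 3 < p) where
  open Unit p-prime 3<p
  open Good p-prime 3<p

  -- That n - d² is prime to p makes the remaining triple non-degenerate and keeps its entries from
  -- being all multiples of p.
  good-reflectable : ∀ {n a b c d} → ¬ P (n - d * d) → Admissible d → Reflectable a b c → Rep n a b c d → Good n
  good-reflectable {n} {a} {b} {c} {d} ¬Pn-d² ok o r = go (P? a) (P? b) (P? c)
    where
    one-multiple : ∀ {a b c} → Reflectable a b c → Rep n a b c d → P a → ¬ P b → ¬ P c → Good n
    one-multiple {a} {b} {c} o r Pa ¬Pb ¬Pc with a ℤ.≟ + 0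
    ... | yes a≡0 = a , b , c , d , r , inj₁ a≡0 , inj₂ ¬Pb , inj₂ ¬Pc , ok
    ... | no a≢0 = unitTriple⇒good ok (unit-oneMultiple (¬Pn-d² ∘ proj₂) o (rep⇒rep₃ r) Pa a≢0 ¬Pb ¬Pc)
    two-multiples : ∀ {a b c} → Reflectable a b c → Rep n a b c d → P a → P b → ¬ P c → Good n
    two-multiples o r Pa Pb ¬Pc = unitTriple⇒good ok (unit-twoMultiples o (rep⇒rep₃ r) Pa Pb ¬Pc)
    go : Dec (P a) → Dec (P b) → Dec (P c) → Good n
    go (no x) (no y) (no z) = a , b , c , d , r , inj₂ x , inj₂ y , inj₂ z , ok
    go (yes x) (no y) (no z) = one-multiple o r x y z
    go (no x) (yes y) (no z) = one-multiple (reflectable-swap₁₂ o) (rep-swap₁₂ r) y x z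
    go (no x) (no y) (yes z) = one-multiple (reflectable-swap₁₂ (reflectable-swap₂₃ o)) (rep-swap₁₂ (rep-swap₂₃ r)) z x y
    go (yes x) (yes y) (no z) = two-multiples o r x y z
    go (yes x) (no y) (yes z) = two-multiples (reflectable-swap₂₃ o) (rep-swap₂₃ r) x z y
    go (no x) (yes y) (yes z) = two-multiples (reflectable-swap₂₃ (reflectable-swap₁₂ o)) (rep-swap₂₃ (rep-swap₁₂ r)) y z x
    go (yes x) (yes y) (yes z) = ⊥-elim (¬Pn-d² (subst P (sum₃≡ (rep⇒rep₃ r)) (lin₃ a b c x y z refl)))

module Five (5-prime : Prime 5) (3<5 : 3 < 5) {n : ℤ} (¬Fn : ¬ F n) (n≢1 : ¬ T (n - + 1)) where
  open Unit 5-prime 3<5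
  open Good 5-prime 3<5
  open Criterion 5-prime 3<5

  -- From d² ≡ - n modulo 5 follows n - d² ≡ 2 n, which is prime to 5, and d is prime to 5 as well.
  criterion : ∀ {a b c d} → F (d * d + n) → Reflectable a b c → Rep n a b c d → Good n
  criterion {d = d} e = good-reflectable
    (λ s → ¬Fn (F-half n (lin₂ (+ 1) (+ 1) s e (solve (n ∷ d ∷ [])))))
    (inj₂ λ s → ¬Fn (lin₂ (+ 1) (- d) e s (solve (n ∷ d ∷ []))))

  F-congruent : ∀ x y → F (x - y) → F (y * y + n) → F (x * x + n)
  F-congruent x y r s = lin₂ (x + y) (+ 1) r s (solve (x ∷ y ∷ n ∷ []))

  F-opposite : ∀ x y → F (x + y) → F (y * y + n) → F (x * x + n)
  F-opposite x y r s = lin₂ (x - y) (+ 1) r s (solve (x ∷ y ∷ n ∷ []))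

  rep-neg₁ : ∀ {a b c d} → Rep n a b c d → Rep n (- a) b c d
  rep-neg₁ {a} {b} {c} {d} (rep s) = rep (trans (cong (λ z → z + b * b + c * c + d * d) (neg-square a)) s)

  -- Both reflections of (a, b, ± d) are tried; if neither helps, then d/3 ≡ b mod 3.
  uuuz-step : ∀ {a b c d} → Rep n a b c d → F a → F (b - + 2 * d) → F (d * d + n) →
    ¬ T b → ¬ T c → ∀ δ → d ≡ δ * + 3 → T (a + b) → Good n ⊎ T (δ - b)
  uuuz-step {a} {b} {c} {d} r Fa Fb Fd ¬Tb ¬Tc δ d≡ Tab = go (+ 3 ∣? t) (+ 3 ∣? (δ - b))
    where
    Td : T d
    Td = divides δ d≡
    sum₊ : T (a + b + d)
    sum₊ = lin₂ (+ 1) (+ 1) Tab Td (solve (a ∷ b ∷ d ∷ []))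
    sum₋ : T (a + b + - d)
    sum₋ = lin₂ (+ 1) (- + 1) Tab Td (solve (a ∷ b ∷ d ∷ []))
    t = _∣ℤ_.quotient sum₊
    t≡ = _∣ℤ_.equality sum₊
    s = _∣ℤ_.quotient sum₋
    s≡ = _∣ℤ_.equality sum₋

    -- Modulo 5, t ≡ d, so the last entry d - 2 t ≡ - d may be left out again. It is a multiple of 3
    -- only if t is.
    plus : ∀ t → a + b + d ≡ t * + 3 → ¬ T t → Good n
    plus t t≡ ¬Tt = go (shape n≢1 r′)
      where
      r′ : Rep n (a - + 2 * t) (b - + 2 * t) c (d - + 2 * t)
      r′ = rep-swap₃₄ (rep₃⇒rep (reflect (rep⇒rep₃ (rep-swap₃₄ r)) t≡))
      F′ : F (d - + 2 * t + d)
      F′ = lin₄ (- + 1) (+ 1) (+ 1) (- + 1) (≡⇒∣ t≡) Fa Fb (F-quintuple (t - d)) (solve (a ∷ b ∷ d ∷ t ∷ []))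
      go : Shape (a - + 2 * t) (b - + 2 * t) c (d - + 2 * t) → Good n
      go (reflectable o) = criterion (F-opposite (d - + 2 * t) d F′ Fd) o r′
      go (uuuz _ _ _ Td′) = ⊥-elim (¬Tt (lin₃ (+ 1) (- + 1) (+ 1) (T-triple t) Td Td′ (solve (t ∷ d ∷ []))))
      go (uzzu _ _ Tc _) = ⊥-elim (¬Tc Tc)
      go (zuzu _ _ Tc _) = ⊥-elim (¬Tc Tc)
      go (zzuu Ta′ Tb′ _ _) = ⊥-elim (¬Tb (lin₄ (- + 1) (+ 1) (- + 1) (+ 1) Tab Ta′ Tb′ (T-triple b) (solve (a ∷ b ∷ t ∷ []))))

    s≡t-2δ : s ≡ t - + 2 * δ
    s≡t-2δ = ℤ.*-cancelʳ-≡ s (t - + 2 * δ) (+ 3) (trans (sym s≡) (trans (id a b d) (trans (cong₂ (λ x y → x - + 2 * y) t≡ d≡) (id′ t δ))))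
      where
      id : ∀ a b d → a + b + - d ≡ a + b + d - + 2 * d
      id = solve-∀
      id′ : ∀ t δ → t * + 3 - + 2 * (δ * + 3) ≡ (t - + 2 * δ) * + 3
      id′ = solve-∀

    -- Modulo 5, s ≡ 2 d, so a - 2 s ≡ d takes over the role of d. Modulo 3, s ≡ δ, so this entry is
    -- congruent to δ - b.
    minus : ∀ t s → a + b + - d ≡ s * + 3 → s ≡ t - + 2 * δ → T t → ¬ T (δ - b) → Good n
    minus t s s≡ s≡t-2δ Tt δ≢b = go (shape n≢1 r′)
      where
      r′ : Rep n (b - + 2 * s) (- d - + 2 * s) c (a - + 2 * s)
      r′ = rep-swap₃₄ (rep-swap₂₃ (rep-swap₁₂ (rep₃⇒rep (reflect (rep₃-neg₃ (rep⇒rep₃ (rep-swap₃₄ r))) s≡))))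
      F′ : F (a - + 2 * s - d)
      F′ = lin₄ (- + 1) (+ 2) (+ 1) (- + 1) (≡⇒∣ s≡) Fa Fb (F-quintuple s) (solve (a ∷ b ∷ d ∷ s ∷ []))
      ¬Ta′ : ¬ T (a - + 2 * s)
      ¬Ta′ r = δ≢b (lin₄ (+ 1) (- + 1) (+ 2) (- + 1) (subst (λ s → T (a - + 2 * s)) s≡t-2δ r) Tab Tt (T-triple δ) (solve (a ∷ b ∷ t ∷ δ ∷ [])))
      go : Shape (b - + 2 * s) (- d - + 2 * s) c (a - + 2 * s) → Good n
      go (reflectable o) = criterion (F-congruent (a - + 2 * s) d F′ Fd) o r′
      go (uuuz _ _ _ Ta′) = ⊥-elim (¬Ta′ Ta′)
      go (uzzu _ _ Tc _) = ⊥-elim (¬Tc Tc)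
      go (zuzu _ _ Tc _) = ⊥-elim (¬Tc Tc)
      go (zzuu Tb′ Td′ _ _) = ⊥-elim (¬Tb (lin₃ (+ 1) (- + 1) (- + 1) Tb′ Td′ Td (solve (b ∷ d ∷ s ∷ []))))

    go : Dec (T t) → Dec (T (δ - b)) → Good n ⊎ T (δ - b)
    go _ (yes q) = inj₂ q
    go (no ¬Tt) _ = inj₁ (plus t t≡ ¬Tt)
    go (yes Tt) (no q) = inj₁ (minus t s s≡ s≡t-2δ Tt q)

  -- If b ≡ - c modulo 3, then d/3 cannot be congruent to both b and c, and one of the steps
  -- succeeds. If b ≡ c, a sign of a makes a + b + c divisible by 3; modulo 5 then k ≡ 3 d, and (a,
  -- b, c) goes to (- d, d, d), prime to 5 at once.
  uuuz-good : ∀ {a b c d} → Rep n a b c d → F a → F (b - + 2 * d) → F (c - + 2 * d) → ¬ F d → F (d * d + n) →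
    ¬ T a → ¬ T b → ¬ T c → T d → Good n
  uuuz-good {a} {b} {c} {d} r Fa Fb Fc ¬Fd Fd ¬Ta ¬Tb ¬Tc (divides δ d≡) =
    either (T± ¬Tb ¬Tc) opposite same
    where
    step-b : Good n ⊎ T (δ - b)
    step-b = either (T± ¬Ta ¬Tb) (uuuz-step r Fa Fb Fd ¬Tb ¬Tc δ d≡)
      (λ t → uuuz-step (rep-neg₁ r) (lin₁ (- + 1) Fa (solve (a ∷ []))) Fb Fd ¬Tb ¬Tc δ d≡ (lin₁ (- + 1) t (solve (a ∷ b ∷ []))))
    step-c : Good n ⊎ T (δ - c)
    step-c = either (T± ¬Ta ¬Tc) (uuuz-step (rep-swap₂₃ r) Fa Fc Fd ¬Tc ¬Tb δ d≡)
      (λ t → uuuz-step (rep-neg₁ (rep-swap₂₃ r)) (lin₁ (- + 1) Fa (solve (a ∷ []))) Fc Fd ¬Tc ¬Tb δ d≡ (lin₁ (- + 1) t (solve (a ∷ c ∷ []))))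
    opposite : T (b + c) → Good n
    opposite t = either step-b (λ g → g) λ δ≡b → either step-c (λ g → g) λ δ≡c →
      ⊥-elim (¬Tb (lin₄ (+ 1) (- + 1) (- + 1) (+ 1) δ≡b δ≡c t (T-triple b) (solve (b ∷ c ∷ δ ∷ []))))
    reflected : ∀ {a} → Rep n a b c d → F a → T (a + b + c) → Good n
    reflected {a} r Fa (divides k k≡) = unitTriple⇒good (inj₂ ¬Fd) (_ , _ , _ , reflect {k = k} (rep⇒rep₃ r) k≡ ,
      (λ s → ¬Fd (lin₄ (+ 1) (- + 2) (- + 1) (- + 1) Fa k≡3d s (F-quintuple d) (solve (a ∷ d ∷ k ∷ [])))) ,
      (λ s → ¬Fd (lin₄ (+ 1) (- + 1) (+ 2) (+ 1) s Fb k≡3d (F-quintuple d) (solve (b ∷ d ∷ k ∷ [])))) ,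
      (λ s → ¬Fd (lin₄ (+ 1) (- + 1) (+ 2) (+ 1) s Fc k≡3d (F-quintuple d) (solve (c ∷ d ∷ k ∷ [])))))
      where
      sum≡4d : F (a + b + c - + 4 * d)
      sum≡4d = lin₃ (+ 1) (+ 1) (+ 1) Fa Fb Fc (solve (a ∷ b ∷ c ∷ d ∷ []))
      k≡3d : F (k - + 3 * d)
      k≡3d = lin₃ (- + 2) (+ 2) (+ 1) (≡⇒∣ k≡) sum≡4d (F-quintuple (d - k)) (solve (a ∷ b ∷ c ∷ d ∷ k ∷ []))
    reflect-same : ∀ {a} → Rep n a b c d → F a → T (a - b) → T (b + - c) → Good n
    reflect-same {a} r Fa a≡b b≡c = reflected r Fa sum
      where
      sum : T (a + b + c)
      sum = lin₃ (+ 1) (- + 1) (+ 1) a≡b b≡c (T-triple b) (solve (a ∷ b ∷ c ∷ []))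
    same : T (b + - c) → Good n
    same b≡c = either (T± ¬Ta ¬Tb)
      (λ t → reflect-same (rep-neg₁ r) (lin₁ (- + 1) Fa (solve (a ∷ []))) (lin₁ (- + 1) t (solve (a ∷ b ∷ []))) b≡c)
      (λ t → reflect-same r Fa t b≡c)

-- The coordinates of the images of (5a, 2d + 5x, 2d + 5y, d) under two isometries with denominator 5:
-- the reflection in (2, 1, 2, -1) and a reflection of the second and fourth coordinates.
data Coordinate : Set where
  va vx vy vd rot : Coordinate

record Form : Set where
  constructor form
  field p q r s : ℤ

coefficients : Coordinate → Form
coefficients va  = form (+ 1) (- + 2) (- + 4) (- + 2)
coefficients vx  = form (- + 2) (+ 4) (- + 2) (+ 1)
coefficients vy  = form (- + 4) (- + 2) (+ 1) (+ 0)
coefficients vd  = form (+ 2) (+ 1) (+ 2) (+ 2)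
coefficients rot = form (+ 0) (+ 4) (+ 0) (+ 1)

value : Coordinate → ℤ → ℤ → ℤ → ℤ → ℤ
value i a x y d = let open Form (coefficients i) in p * a + q * x + r * y + s * d

Rep₅ : ℤ → ℤ → ℤ → ℤ → ℤ → Set
Rep₅ n a x y d = Rep n (a * + 5) (+ 2 * d + x * + 5) (+ 2 * d + y * + 5) d

-- For v = (2, 1, 2, -1), v·v = 10 and the scalar product with the given vector is 5 (2 a + x + 2 y
-- + d), whence integrality.
v-move : ∀ {n} a x y d → Rep₅ n a x y d → Rep n (value va a x y d) (value vx a x y d) (value vy a x y d) (value vd a x y d)
v-move a x y d (rep refl) = rep (id a x y d)
  where
  id : ∀ a x y d →
    (+ 1 * a + - + 2 * x + - + 4 * y + - + 2 * d) * (+ 1 * a + - + 2 * x + - + 4 * y + - + 2 * d)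
    + (- + 2 * a + + 4 * x + - + 2 * y + + 1 * d) * (- + 2 * a + + 4 * x + - + 2 * y + + 1 * d)
    + (- + 4 * a + - + 2 * x + + 1 * y + + 0 * d) * (- + 4 * a + - + 2 * x + + 1 * y + + 0 * d)
    + (+ 2 * a + + 1 * x + + 2 * y + + 2 * d) * (+ 2 * a + + 1 * x + + 2 * y + + 2 * d) ≡
    a * + 5 * (a * + 5) + (+ 2 * d + x * + 5) * (+ 2 * d + x * + 5) + (+ 2 * d + y * + 5) * (+ 2 * d + y * + 5) + d * d
  id = solve-∀

-- The reflection in (0, 1, 0, -2); the scalar product is 5 x.
rot-move : ∀ {n} a x y d → Rep₅ n a x y d → Rep n (a * + 5) (+ 2 * d + + 3 * x) (+ 2 * d + y * + 5) (value rot a x y d)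
rot-move a x y d (rep refl) = rep (id a x y d)
  where
  id : ∀ a x y d → a * + 5 * (a * + 5) + (+ 2 * d + + 3 * x) * (+ 2 * d + + 3 * x) + (+ 2 * d + y * + 5) * (+ 2 * d + y * + 5)
    + (+ 0 * a + + 4 * x + + 0 * y + + 1 * d) * (+ 0 * a + + 4 * x + + 0 * y + + 1 * d) ≡
    a * + 5 * (a * + 5) + (+ 2 * d + x * + 5) * (+ 2 * d + x * + 5) + (+ 2 * d + y * + 5) * (+ 2 * d + y * + 5) + d * d
  id = solve-∀

reach : ∀ i {n} a x y d → Rep₅ n a x y d → ∃[ u ] ∃[ v ] ∃[ w ] Rep n u v w (value i a x y d)
reach va a x y d r = _ , _ , _ , rep-swap₃₄ (rep-swap₂₃ (rep-swap₁₂ (v-move a x y d r)))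
reach vx a x y d r = _ , _ , _ , rep-swap₃₄ (rep-swap₂₃ (v-move a x y d r))
reach vy a x y d r = _ , _ , _ , rep-swap₃₄ (v-move a x y d r)
reach vd a x y d r = _ , _ , _ , v-move a x y d r
reach rot a x y d r = _ , _ , _ , rot-move a x y d r

rep₅-swap : ∀ {n} a x y d → Rep₅ n a x y d → Rep₅ n a y x d
rep₅-swap a x y d = rep-swap₂₃

rep₅-neg : ∀ {n} a x y d → Rep₅ n a x y d → Rep₅ n (- a) x y d
rep₅-neg a x y d (rep refl) = rep (id a x y d)
  where
  id : ∀ a x y d → - a * + 5 * (- a * + 5) + (+ 2 * d + x * + 5) * (+ 2 * d + x * + 5) + (+ 2 * d + y * + 5) * (+ 2 * d + y * + 5) + d * d ≡
    a * + 5 * (a * + 5) + (+ 2 * d + x * + 5) * (+ 2 * d + x * + 5) + (+ 2 * d + y * + 5) * (+ 2 * d + y * + 5) + d * d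
  id = solve-∀

-- As d² ≡ - n modulo 5, a coordinate of the image with the same square modulo 5 may be left out in
-- place of d.
record Hit (a x y d : ℤ) (i : Coordinate) : Set where
  constructor hit
  field square≡ : F (value i a x y d * value i a x y d - d * d)

F-square-cong : ∀ x y x′ y′ → F (x - x′) → F (y - y′) → F (x′ * x′ - y′ * y′) → F (x * x - y * y)
F-square-cong x y x′ y′ r s t = lin₃ (x + x′) (- (y + y′)) (+ 1) r s t (solve (x ∷ y ∷ x′ ∷ y′ ∷ []))

hit-cong : ∀ {a x y d a′ x′ y′ d′} → F (a - a′) → F (x - x′) → F (y - y′) → F (d - d′) → ∀ {i} → Hit a′ x′ y′ d′ i → Hit a x y d i
hit-cong {a} {x} {y} {d} {a′} {x′} {y′} {d′} ra rx ry rd {i} (hit h) =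
  hit (F-square-cong (value i a x y d) d (value i a′ x′ y′ d′) d′
    (lin₄ p q r s ra rx ry rd (id p q r s a x y d a′ x′ y′ d′)) rd h)
  where
  open Form (coefficients i)
  id : ∀ p q r s a x y d a′ x′ y′ d′ → p * a + q * x + r * y + s * d - (p * a′ + q * x′ + r * y′ + s * d′) ≡
    p * (a - a′) + q * (x - x′) + r * (y - y′) + s * (d - d′)
  id = solve-∀

hit? : ∀ a x y d i → Dec (Hit a x y d i)
hit? a x y d i = map′ hit Hit.square≡ (+ 5 ∣? (value i a x y d * value i a x y d - d * d))

F-residue : ∀ x → ∃[ r ] F (x - + toℕ {5} r)
F-residue x = fromℕ< (ℤ.n%ℕd<d x 5) , divides (x ℤ./ℕ 5)
  (trans (cong₂ (λ y r → y - + r) (ℤ.a≡a%ℕn+[a/ℕn]*n x 5) (Fin.toℕ-fromℕ< (ℤ.n%ℕd<d x 5))) (id (+ (x ℤ.%ℕ 5)) (x ℤ./ℕ 5 * + 5)))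
  where
  id : ∀ r q → r + q - r ≡ q
  id = solve-∀

-- In the last two alternatives of CheckX, CheckY₁ and CheckY₂ no image is good; these lead to the 5-adic descent.
CheckX : ℤ → ℤ → ℤ → ℤ → Set
CheckX a b c d =
  F d
  ⊎ Any (Hit a b c d) (rot ∷ vx ∷ vy ∷ []) ⊎ Any (Hit a c b d) (rot ∷ vx ∷ vy ∷ [])
  ⊎ Any (Hit (- a) b c d) (va ∷ vd ∷ []) ⊎ Any (Hit (- a) c b d) (va ∷ vd ∷ [])
  ⊎ (F (b + d) × F (c + d))
  ⊎ (F (a + d) × F (b - d) × F (c - d))

checkX? : ∀ a b c d → Dec (CheckX a b c d)
checkX? a b c d =
  (+ 5 ∣? d)
  ⊎-dec Any.any? (hit? a b c d) _ ⊎-dec Any.any? (hit? a c b d) _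
  ⊎-dec Any.any? (hit? (- a) b c d) _ ⊎-dec Any.any? (hit? (- a) c b d) _
  ⊎-dec ((+ 5 ∣? (b + d)) ×-dec (+ 5 ∣? (c + d)))
  ⊎-dec ((+ 5 ∣? (a + d)) ×-dec (+ 5 ∣? (b - d)) ×-dec (+ 5 ∣? (c - d)))

All₅ : (ℤ → ℤ → ℤ → ℤ → Set) → Set
All₅ Q = (a b c d : Fin 5) → Q (+ toℕ a) (+ toℕ b) (+ toℕ c) (+ toℕ d)

all₅? : ∀ {Q} → (∀ a b c d → Dec (Q a b c d)) → Dec (All₅ Q)
all₅? Q? = Fin.all? λ a → Fin.all? λ b → Fin.all? λ c → Fin.all? λ d → Q? (+ toℕ a) (+ toℕ b) (+ toℕ c) (+ toℕ d)

CheckY₁ : ℤ → ℤ → ℤ → ℤ → Set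
CheckY₁ a b c d =
  F d
  ⊎ Any (Hit a b c d) (va ∷ vy ∷ []) ⊎ Any (Hit (- a) b c d) (va ∷ vy ∷ [])
  ⊎ Any (Hit a c b d) (vy ∷ vd ∷ rot ∷ []) ⊎ Any (Hit (- a) c b d) (vy ∷ vd ∷ [])
  ⊎ (F a × F (c + + 2 * b))
  ⊎ (F a × F (c + + 2 * b - d))

checkY₁? : ∀ a b c d → Dec (CheckY₁ a b c d)
checkY₁? a b c d =
  (+ 5 ∣? d)
  ⊎-dec Any.any? (hit? a b c d) _ ⊎-dec Any.any? (hit? (- a) b c d) _
  ⊎-dec Any.any? (hit? a c b d) _ ⊎-dec Any.any? (hit? (- a) c b d) _
  ⊎-dec ((+ 5 ∣? a) ×-dec (+ 5 ∣? (c + + 2 * b)))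
  ⊎-dec ((+ 5 ∣? a) ×-dec (+ 5 ∣? (c + + 2 * b - d)))

CheckY₂ : ℤ → ℤ → ℤ → ℤ → Set
CheckY₂ a b c d =
  F d
  ⊎ Any (Hit a b c d) (vx ∷ vd ∷ []) ⊎ Any (Hit (- a) b c d) (vx ∷ vd ∷ [])
  ⊎ Any (Hit a c b d) (va ∷ vx ∷ rot ∷ []) ⊎ Any (Hit (- a) c b d) (va ∷ vx ∷ [])
  ⊎ (F a × F (b + + 2 * c - d))
  ⊎ (F a × F (b + + 2 * c - + 3 * d))

checkY₂? : ∀ a b c d → Dec (CheckY₂ a b c d)
checkY₂? a b c d =
  (+ 5 ∣? d)
  ⊎-dec Any.any? (hit? a b c d) _ ⊎-dec Any.any? (hit? (- a) b c d) _
  ⊎-dec Any.any? (hit? a c b d) _ ⊎-dec Any.any? (hit? (- a) c b d) _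
  ⊎-dec ((+ 5 ∣? a) ×-dec (+ 5 ∣? (b + + 2 * c - d)))
  ⊎-dec ((+ 5 ∣? a) ×-dec (+ 5 ∣? (b + + 2 * c - + 3 * d)))

Congruent : (ℤ → ℤ → ℤ → ℤ → Set) → Set
Congruent Q = ∀ {a b c d a′ b′ c′ d′} → F (a - a′) → F (b - b′) → F (c - c′) → F (d - d′) → Q a′ b′ c′ d′ → Q a b c d

all₅⇒all : ∀ {Q} → Congruent Q → All₅ Q → ∀ a b c d → Q a b c d
all₅⇒all cong-Q all-Q a b c d =
  let a′ , ra = F-residue a ; b′ , rb = F-residue b ; c′ , rc = F-residue c ; d′ , rd = F-residue d in
  cong-Q ra rb rc rd (all-Q a′ b′ c′ d′)

F-neg-cong : ∀ x y → F (x - y) → F (- x - - y)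
F-neg-cong x y r = lin₁ (- + 1) r (solve (x ∷ y ∷ []))

F-cong₁ : ∀ x y → F (x - y) → F y → F x
F-cong₁ x y r s = lin₂ (+ 1) (+ 1) r s (solve (x ∷ y ∷ []))

checkX : ∀ a b c d → CheckX a b c d
checkX = all₅⇒all congruent (toWitness {a? = all₅? checkX?} _)
  where
  congruent : Congruent CheckX
  congruent {a} {b} {c} {d} {a′} {b′} {c′} {d′} ra rb rc rd =
    Sum.map (F-cong₁ d d′ rd) (Sum.map (Any.map (hit-cong ra rb rc rd)) (Sum.map (Any.map (hit-cong ra rc rb rd))
    (Sum.map (Any.map (hit-cong (F-neg-cong a a′ ra) rb rc rd)) (Sum.map (Any.map (hit-cong (F-neg-cong a a′ ra) rc rb rd))
    (Sum.map (Product.map (plus b d b′ d′ rb rd) (plus c d c′ d′ rc rd))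
      (Product.map (plus a d a′ d′ ra rd) (Product.map (minus b d b′ d′ rb rd) (minus c d c′ d′ rc rd))))))))
    where
    plus : ∀ x y x′ y′ → F (x - x′) → F (y - y′) → F (x′ + y′) → F (x + y)
    plus x y x′ y′ r s t = lin₃ (+ 1) (+ 1) (+ 1) r s t (solve (x ∷ y ∷ x′ ∷ y′ ∷ []))
    minus : ∀ x y x′ y′ → F (x - x′) → F (y - y′) → F (x′ - y′) → F (x - y)
    minus x y x′ y′ r s t = lin₃ (+ 1) (- + 1) (+ 1) r s t (solve (x ∷ y ∷ x′ ∷ y′ ∷ []))

checkY₁ : ∀ a b c d → CheckY₁ a b c d
checkY₁ = all₅⇒all congruent (toWitness {a? = all₅? checkY₁?} _)
  where
  congruent : Congruent CheckY₁
  congruent {a} {b} {c} {d} {a′} {b′} {c′} {d′} ra rb rc rd =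
    Sum.map (F-cong₁ d d′ rd) (Sum.map (Any.map (hit-cong ra rb rc rd)) (Sum.map (Any.map (hit-cong (F-neg-cong a a′ ra) rb rc rd))
    (Sum.map (Any.map (hit-cong ra rc rb rd)) (Sum.map (Any.map (hit-cong (F-neg-cong a a′ ra) rc rb rd))
    (Sum.map (Product.map (F-cong₁ a a′ ra) e₁) (Product.map (F-cong₁ a a′ ra) e₂))))))
    where
    e₁ : F (c′ + + 2 * b′) → F (c + + 2 * b)
    e₁ r = lin₃ (+ 1) (+ 2) (+ 1) rc rb r (solve (b ∷ c ∷ b′ ∷ c′ ∷ []))
    e₂ : F (c′ + + 2 * b′ - d′) → F (c + + 2 * b - d)
    e₂ r = lin₄ (+ 1) (+ 2) (- + 1) (+ 1) rc rb rd r (solve (b ∷ c ∷ d ∷ b′ ∷ c′ ∷ d′ ∷ []))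

checkY₂ : ∀ a b c d → CheckY₂ a b c d
checkY₂ = all₅⇒all congruent (toWitness {a? = all₅? checkY₂?} _)
  where
  congruent : Congruent CheckY₂
  congruent {a} {b} {c} {d} {a′} {b′} {c′} {d′} ra rb rc rd =
    Sum.map (F-cong₁ d d′ rd) (Sum.map (Any.map (hit-cong ra rb rc rd)) (Sum.map (Any.map (hit-cong (F-neg-cong a a′ ra) rb rc rd))
    (Sum.map (Any.map (hit-cong ra rc rb rd)) (Sum.map (Any.map (hit-cong (F-neg-cong a a′ ra) rc rb rd))
    (Sum.map (Product.map (F-cong₁ a a′ ra) e₁) (Product.map (F-cong₁ a a′ ra) e₂))))))
    where
    e₁ : F (b′ + + 2 * c′ - d′) → F (b + + 2 * c - d)
    e₁ r = lin₄ (+ 2) (+ 1) (- + 1) (+ 1) rc rb rd r (solve (b ∷ c ∷ d ∷ b′ ∷ c′ ∷ d′ ∷ []))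
    e₂ : F (b′ + + 2 * c′ - + 3 * d′) → F (b + + 2 * c - + 3 * d)
    e₂ r = lin₄ (+ 2) (+ 1) (- + 3) (+ 1) rc rb rd r (solve (b ∷ c ∷ d ∷ b′ ∷ c′ ∷ d′ ∷ []))

rep-neg₄ : ∀ {n a b c d} → Rep n a b c d → Rep n a b c (- d)
rep-neg₄ {a = a} {b} {c} {d} (rep refl) = rep (cong (λ s → a * a + b * b + c * c + s) (neg-square d))

rep-neg₃ : ∀ {n a b c d} → Rep n a b c d → Rep n a b (- c) d
rep-neg₃ r = rep-swap₃₄ (rep-neg₄ (rep-swap₃₄ r))

rep-neg₂ : ∀ {n a b c d} → Rep n a b c d → Rep n a (- b) c d
rep-neg₂ r = rep-swap₂₃ (rep-neg₃ (rep-swap₂₃ r))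

-- The four coordinates of the reflection in (2, 1, 2, -1), expanded for explicit computation.
module Image (a x y d : ℤ) where
  a′ x′ y′ d′ : ℤ
  a′ = a - + 2 * x - + 4 * y - + 2 * d
  x′ = d + + 4 * x - + 2 * a - + 2 * y
  y′ = y - + 4 * a - + 2 * x
  d′ = + 2 * d + + 2 * a + x + + 2 * y

-- The descent on powers of 5

module XY (5-prime : Prime 5) (3<5 : 3 < 5) {n : ℤ} (¬Fn : ¬ F n) (n≢1 : ¬ T (n - + 1)) (n≡2 : T (n + + 1)) where
  open Unit 5-prime 3<5 hiding (Bad; b+c)
  open Good 5-prime 3<5
  open Five 5-prime 3<5 ¬Fn n≢1

  -- With n ≡ 2 and d ≡ 0 modulo 3, the other squares add up to 2, so exactly one of those entries
  -- is a multiple of 3.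
  criterion₂ : ∀ {a b c d} → Rep n a b c d → T d → F (d * d + n) → Good n
  criterion₂ {a} {b} {c} {d} r Td Fd = go (shape n≢1 r)
    where
    go : Shape a b c d → Good n
    go (reflectable o) = criterion Fd o r
    go (uuuz ¬Ta ¬Tb ¬Tc _) = ⊥-elim (from-no (+ 3 ∣? + 4) (lin₅ (+ 1) (- + 1) (- + 1) (- + 1) (- d)
      n≡2 (T-square-1 ¬Ta) (T-square-1 ¬Tb) (T-square-1 ¬Tc) Td (trans (id a b c d) (cong (λ n → + 1 * (n + + 1)
        + - + 1 * (a * a - + 1) + - + 1 * (b * b - + 1) + - + 1 * (c * c - + 1) + - d * d) (sum≡ r)))))
      where
      id : ∀ a b c d → + 4 ≡ + 1 * (a * a + b * b + c * c + d * d + + 1)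
        + - + 1 * (a * a - + 1) + - + 1 * (b * b - + 1) + - + 1 * (c * c - + 1) + - d * d
      id = solve-∀
    go (uzzu _ _ _ ¬Td) = ⊥-elim (¬Td Td)
    go (zuzu _ _ _ ¬Td) = ⊥-elim (¬Td Td)
    go (zzuu _ _ _ ¬Td) = ⊥-elim (¬Td Td)

  F-d²+n : ∀ a x y d → Rep₅ n a x y d → F (d * d + n)
  F-d²+n a x y d (rep s) = divides (+ 5 * a * a + + 2 * d * d + + 4 * d * x + + 5 * x * x + + 4 * d * y + + 5 * y * y)
    (trans (cong (λ n → d * d + n) (sym s)) (id a x y d))
    where
    id : ∀ a x y d → d * d + (a * + 5 * (a * + 5) + (+ 2 * d + x * + 5) * (+ 2 * d + x * + 5) + (+ 2 * d + y * + 5) * (+ 2 * d + y * + 5) + d * d) ≡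
      (+ 5 * a * a + + 2 * d * d + + 4 * d * x + + 5 * x * x + + 4 * d * y + + 5 * y * y) * + 5
    id = solve-∀

  ¬F-d : ∀ d → F (d * d + n) → ¬ F d
  ¬F-d d Fd r = ¬Fn (lin₂ (+ 1) (- d) Fd r (solve (d ∷ n ∷ [])))

  -- If a ≡ α d, x ≡ β d and y ≡ γ d modulo 3, coordinate i is `total i α β γ` times d modulo 3. The
  -- lists in the checks hold only coordinates for which this is 0, so a hit meets `criterion₂`.
  total : Coordinate → ℤ → ℤ → ℤ → ℤ
  total i α β γ = let open Form (coefficients i) in p * α + q * β + r * γ + s

  hits : ∀ α β γ is {_ : True (All.all? (λ i → + 3 ∣? total i α β γ) is)} a x y d → Rep₅ n a x y d →
    T (a - α * d) → T (x - β * d) → T (y - γ * d) → Any (Hit a x y d) is → Good n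
  hits α β γ is {ok} a x y d rep₅ Ta Tx Ty any = go _ (All.lookupAny (toWitness ok) any)
    where
    T-value : ∀ i → T (total i α β γ) → T (value i a x y d)
    T-value i t = lin₄ p q r d Ta Tx Ty t (id p q r s a x y d α β γ)
      where
      open Form (coefficients i)
      id : ∀ p q r s a x y d α β γ → p * a + q * x + r * y + s * d ≡
        p * (a - α * d) + q * (x - β * d) + r * (y - γ * d) + d * (p * α + q * β + r * γ + s)
      id = solve-∀
    go : ∀ i → T (total i α β γ) × Hit a x y d i → Good n
    go i (t , hit h) = let _ , _ , _ , r′ = reach i a x y d rep₅ in
      criterion₂ r′ (T-value i t) (lin₂ (+ 1) (+ 1) h (F-d²+n a x y d rep₅) (id (value i a x y d) d n))
      where
      id : ∀ v d n → v * v + n ≡ + 1 * (v * v - d * d) + + 1 * (d * d + n)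
      id = solve-∀

  image : ∀ a x y d → Rep₅ n a x y d → let open Image a x y d in Rep n a′ x′ y′ d′
  image a x y d (rep s) = rep (trans (id a x y d) s)
    where
    id : ∀ a x y d →
      (a - + 2 * x - + 4 * y - + 2 * d) * (a - + 2 * x - + 4 * y - + 2 * d)
      + (d + + 4 * x - + 2 * a - + 2 * y) * (d + + 4 * x - + 2 * a - + 2 * y)
      + (y - + 4 * a - + 2 * x) * (y - + 4 * a - + 2 * x)
      + (+ 2 * d + + 2 * a + x + + 2 * y) * (+ 2 * d + + 2 * a + x + + 2 * y) ≡
      a * + 5 * (a * + 5) + (+ 2 * d + x * + 5) * (+ 2 * d + x * + 5) + (+ 2 * d + y * + 5) * (+ 2 * d + y * + 5) + d * d
    id = solve-∀

  rotation : ∀ a x y d → Rep₅ n a x y d → Rep n (a * + 5) (+ 2 * d + + 3 * x) (+ 2 * d + y * + 5) (d + + 4 * x)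
  rotation a x y d (rep s) = rep (trans (id a x y d) s)
    where
    id : ∀ a x y d → a * + 5 * (a * + 5) + (+ 2 * d + + 3 * x) * (+ 2 * d + + 3 * x) + (+ 2 * d + y * + 5) * (+ 2 * d + y * + 5)
      + (d + + 4 * x) * (d + + 4 * x) ≡
      a * + 5 * (a * + 5) + (+ 2 * d + x * + 5) * (+ 2 * d + x * + 5) + (+ 2 * d + y * + 5) * (+ 2 * d + y * + 5) + d * d
    id = solve-∀

  F-cancel : ∀ c → ¬ F c → ∀ z → F (c * z) → F z
  F-cancel c ¬Fc z r = either (prime-∣ℤ-* 5-prime c z r) (λ s → ⊥-elim (¬Fc s)) (λ s → s)

  to-rep₅ : ∀ {P B C D} a b c → P ≡ a * + 5 → B - + 2 * D ≡ b * + 5 → C - + 2 * D ≡ c * + 5 → Rep n P B C D → Rep₅ n a b c D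
  to-rep₅ {P} {B} {C} {D} a b c refl eb ec (rep s) = rep (trans (cong₂ (λ x y → P * P + x * x + y * y + D * D) (sym (shift B b eb)) (sym (shift C c ec))) s)
    where
    id : ∀ B D → B ≡ + 2 * D + (B - + 2 * D)
    id = solve-∀
    shift : ∀ B b → B - + 2 * D ≡ b * + 5 → B ≡ + 2 * D + b * + 5
    shift B b e = trans (id B D) (cong (λ z → + 2 * D + z) e)

  -- Modulo 15 up to signs and units, X is (5, 3, 3, 1), and Y is (0, 2, 3, 1) or (0, 2, 3, 4).
  record X (m : ℕ) (P B C D : ℤ) : Set where
    constructor X-data
    field
      X-rep : Rep n P B C D
      F-P   : F P
      F-B   : F (B - + 2 * D)
      F-C   : F (C - + 2 * D)
      T-P+D : T (P + D)
      T-B   : T B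
      T-C   : T C
      ¬T-D  : ¬ T D
      small : ¬ (+ 5) ^ m ∣ℤ B - C

  record Y (m : ℕ) (P B C D : ℤ) : Set where
    constructor Y-data
    field
      Y-rep : Rep n P B C D
      F-P   : F P
      F-B   : F (B - + 2 * D)
      F-C   : F (C - + 2 * D)
      T-P   : T P
      ¬T-B  : ¬ T B
      T-C   : T C
      ¬T-D  : ¬ T D
      small : ¬ (+ 5) ^ m ∣ℤ P

  1∣ : ∀ z → (+ 5) ^ 0 ∣ℤ z
  1∣ z = divides z (sym (ℤ.*-identityʳ z))

  -- This and the next four lemmas bring residues modulo 3 into the form a ≡ α d that `hits`
  -- expects, which is why even α = 0 and α = 1 are written out.
  T-5a+d : ∀ {P D} a → P ≡ a * + 5 → T (P + D) → T (a - + 1 * D)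
  T-5a+d {P} {D} a e t = lin₃ (+ 2) (- + 2) (- + 1) t (≡⇒∣ e) (T-triple (+ 3 * a + D)) (solve (P ∷ D ∷ a ∷ []))

  T-5a : ∀ {P} a D → P ≡ a * + 5 → T P → T (a - + 0 * D)
  T-5a {P} a D e t = lin₃ (+ 2) (- + 2) (- + 1) t (≡⇒∣ e) (T-triple (+ 3 * a)) (solve (P ∷ a ∷ D ∷ []))

  T-2d+5b : ∀ {B D} b → B - + 2 * D ≡ b * + 5 → T B → T (b - - + 1 * D)
  T-2d+5b {B} {D} b e t = lin₃ (+ 2) (- + 2) (- + 1) t (≡⇒∣ e) (T-triple (D + + 3 * b)) (solve (B ∷ D ∷ b ∷ []))

  T-2d+5b₁ : ∀ {B D} b → B - + 2 * D ≡ b * + 5 → T (B + - D) → T (b - + 1 * D)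
  T-2d+5b₁ {B} {D} b e t = lin₃ (+ 2) (- + 2) (- + 1) t (≡⇒∣ e) (T-triple (D + + 3 * b)) (solve (B ∷ D ∷ b ∷ []))

  T-2d+5b₂ : ∀ {B D} b → B - + 2 * D ≡ b * + 5 → T (B + D) → T (b - + 0 * D)
  T-2d+5b₂ {B} {D} b e t = lin₃ (+ 2) (- + 2) (- + 1) t (≡⇒∣ e) (T-triple (+ 2 * D + + 3 * b)) (solve (B ∷ D ∷ b ∷ []))

  -- If f is linear, then f a and f (- a) differ by a multiple of a, so one of them is at most as divisible by 5 as a.
  choose-sign : ∀ m (f : ℤ → ℤ) k → ¬ F k → (∀ a → k * a ≡ + 1 * f a + - + 1 * f (- a)) → ∀ a → ¬ (+ 5) ^ m ∣ℤ a →
    ¬ (+ 5) ^ m ∣ℤ f a ⊎ ¬ (+ 5) ^ m ∣ℤ f (- a)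
  choose-sign m f k ¬Fk eq a small = go ((+ 5) ^ m ∣? f a)
    where
    go : Dec ((+ 5) ^ m ∣ℤ f a) → ¬ (+ 5) ^ m ∣ℤ f a ⊎ ¬ (+ 5) ^ m ∣ℤ f (- a)
    go (no q) = inj₁ q
    go (yes q) = inj₂ λ q′ → small (^-∣-cancel k (F-cancel k ¬Fk) m a (lin₂ (+ 1) (- + 1) q q′ (eq a)))

  mutual
    -- The factor 5 in B - C = 5 (b - c) pays for the drop of m; the step itself only has to
    -- preserve the exponent. The measure is B - C because exchanging b and c is the symmetry left
    -- free modulo 3, as the sign of a is for `Y`.
    X-good : ∀ m {P B C D} → X m P B C D → Good n
    X-good zero (X-data _ _ _ _ _ _ _ _ small) = ⊥-elim (small (1∣ _))
    X-good (suc m) {P} {B} {C} {D} (X-data r (divides a P≡) (divides b B≡) (divides c C≡) T-P+D TB TC ¬TD small) =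
      X-step m a b c D (to-rep₅ a b c P≡ B≡ C≡ r) (T-5a+d a P≡ T-P+D) (T-2d+5b b B≡ TB) (T-2d+5b c C≡ TC) ¬TD
        (small ∘ ^-∣-suc (+ 5) m (trans (id₁ B C D) (trans (cong₂ _-_ B≡ C≡) (id₂ b c))))
      where
      id₁ : ∀ B C D → B - C ≡ B - + 2 * D - (C - + 2 * D)
      id₁ = solve-∀
      id₂ : ∀ b c → b * + 5 - c * + 5 ≡ + 5 * (b - c)
      id₂ = solve-∀

    X-step : ∀ m a b c d → Rep₅ n a b c d → T (a - + 1 * d) → T (b - - + 1 * d) → T (c - - + 1 * d) → ¬ T d →
      ¬ (+ 5) ^ m ∣ℤ b - c → Good n
    X-step m a b c d r Ta Tb Tc ¬Td small = go (checkX a b c d)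
      where
      T-a : T (- a - - + 1 * d)
      T-a = lin₁ (- + 1) Ta (solve (a ∷ d ∷ []))

      -- The measures for the two orders of b and c differ by 9 (b - c), and those in `imaged` by 6
      -- (b - c); both factors are prime to 5.
      rotated : F (b + d) → F (c + d) → Dec ((+ 5) ^ m ∣ℤ + 2 * d + c * + 5 - (d + + 4 * b)) → Good n
      rotated Fb Fc (no q) = X-rotated m a b c d r Ta Tb Tc ¬Td Fb Fc q
      rotated Fb Fc (yes q) = X-rotated m a c b d (rep₅-swap a b c d r) Ta Tc Tb ¬Td Fc Fb λ q′ →
        small (^-∣-cancel (+ 9) (F-cancel (+ 9) (from-no (+ 5 ∣? + 9))) m (b - c)
          (lin₂ (- + 1) (+ 1) q q′ (solve (b ∷ c ∷ d ∷ []))))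

      imaged : F (a + d) → F (b - d) → F (c - d) → Dec ((+ 5) ^ m ∣ℤ Image.x′ a b c d) → Good n
      imaged Fa Fb Fc (no q) = X-image m a b c d r Ta Tb Tc ¬Td Fa Fb Fc q
      imaged Fa Fb Fc (yes q) = X-image m a c b d (rep₅-swap a b c d r) Ta Tc Tb ¬Td Fa Fc Fb λ q′ →
        small (^-∣-cancel (+ 6) (F-cancel (+ 6) (from-no (+ 5 ∣? + 6))) m (b - c)
          (lin₂ (+ 1) (- + 1) q q′ (id a b c d)))
        where
        id : ∀ a b c d → + 6 * (b - c) ≡ + 1 * (d + + 4 * b - + 2 * a - + 2 * c) + - + 1 * (d + + 4 * c - + 2 * a - + 2 * b)
        id = solve-∀

      go : CheckX a b c d → Good n
      go (inj₁ Fd) = ⊥-elim (¬F-d d (F-d²+n a b c d r) Fd)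
      go (inj₂ (inj₁ h)) = hits (+ 1) (- + 1) (- + 1) _ a b c d r Ta Tb Tc h
      go (inj₂ (inj₂ (inj₁ h))) = hits (+ 1) (- + 1) (- + 1) _ a c b d (rep₅-swap a b c d r) Ta Tc Tb h
      go (inj₂ (inj₂ (inj₂ (inj₁ h)))) = hits (- + 1) (- + 1) (- + 1) _ (- a) b c d (rep₅-neg a b c d r) T-a Tb Tc h
      go (inj₂ (inj₂ (inj₂ (inj₂ (inj₁ h))))) = hits (- + 1) (- + 1) (- + 1) _ (- a) c b d (rep₅-swap (- a) b c d (rep₅-neg a b c d r)) T-a Tc Tb h
      go (inj₂ (inj₂ (inj₂ (inj₂ (inj₂ (inj₁ (Fb , Fc))))))) = rotated Fb Fc (_ ∣? _)
      go (inj₂ (inj₂ (inj₂ (inj₂ (inj₂ (inj₂ (Fa , Fb , Fc))))))) = imaged Fa Fb Fc (_ ∣? _)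

    -- Modulo 5 the image is (0, - d, 2 d, 2 d): the second coordinate, negated, takes over the role
    -- of d.
    X-rotated : ∀ m a x y d → Rep₅ n a x y d → T (a - + 1 * d) → T (x - - + 1 * d) → T (y - - + 1 * d) → ¬ T d →
      F (x + d) → F (y + d) → ¬ (+ 5) ^ m ∣ℤ + 2 * d + y * + 5 - (d + + 4 * x) → Good n
    X-rotated m a x y d r Ta Tx Ty ¬Td Fx Fy small = X-good m (X-data r′ FP FB FC TP+D TB TC ¬TD small)
      where
      r′ : Rep n (a * + 5) (+ 2 * d + y * + 5) (d + + 4 * x) (- (+ 2 * d + + 3 * x))
      r′ = rep-neg₄ (rep-swap₃₄ (rep-swap₂₃ (rotation a x y d r)))
      FP : F (a * + 5)
      FP = divides a refl
      FB : F (+ 2 * d + y * + 5 - + 2 * - (+ 2 * d + + 3 * x))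
      FB = lin₂ (+ 6) (+ 1) Fx (F-quintuple y) (solve (d ∷ x ∷ y ∷ []))
      FC : F (d + + 4 * x - + 2 * - (+ 2 * d + + 3 * x))
      FC = lin₁ (+ 1) (F-quintuple (d + + 2 * x)) (solve (d ∷ x ∷ []))
      TP+D : T (a * + 5 + - (+ 2 * d + + 3 * x))
      TP+D = lin₂ (+ 5) (+ 1) Ta (T-triple (d - x)) (solve (a ∷ d ∷ x ∷ []))
      TB : T (+ 2 * d + y * + 5)
      TB = lin₂ (+ 5) (- + 1) Ty (T-triple d) (solve (d ∷ y ∷ []))
      TC : T (d + + 4 * x)
      TC = lin₂ (+ 4) (- + 1) Tx (T-triple d) (solve (d ∷ x ∷ []))
      ¬TD : ¬ T (- (+ 2 * d + + 3 * x))
      ¬TD t = ¬Td (lin₂ (+ 1) (+ 1) t (T-triple (d + x)) (solve (d ∷ x ∷ [])))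

    -- The image is (d, 0, 3 d, 3 d) modulo 5 and (- d, 0, 0, d) modulo 3, which is `Y` up to order
    -- and signs.
    X-image : ∀ m a x y d → Rep₅ n a x y d → T (a - + 1 * d) → T (x - - + 1 * d) → T (y - - + 1 * d) → ¬ T d →
      F (a + d) → F (x - d) → F (y - d) → ¬ (+ 5) ^ m ∣ℤ Image.x′ a x y d → Good n
    X-image m a x y d r Ta Tx Ty ¬Td Fa Fx Fy small = Y-good m (Y-data r′ FP FB FC TP ¬TB TC ¬TD small)
      where
      r′ : let open Image a x y d in Rep n x′ (- d′) (- y′) a′
      r′ = rep-neg₃ (rep-neg₂ (rep-swap₃₄ (rep-swap₂₃ (rep-swap₃₄ (rep-swap₁₂ (image a x y d r))))))
      FP : F (d + + 4 * x - + 2 * a - + 2 * y)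
      FP = lin₄ (- + 2) (+ 4) (- + 2) (+ 1) Fa Fx Fy (F-quintuple d) (solve (a ∷ x ∷ y ∷ d ∷ []))
      FB : F (- (+ 2 * d + + 2 * a + x + + 2 * y) - + 2 * (a - + 2 * x - + 4 * y - + 2 * d))
      FB = lin₄ (- + 4) (+ 3) (+ 6) (+ 3) Fa Fx Fy (F-quintuple d) (solve (a ∷ x ∷ y ∷ d ∷ []))
      FC : F (- (y - + 4 * a - + 2 * x) - + 2 * (a - + 2 * x - + 4 * y - + 2 * d))
      FC = lin₄ (+ 2) (+ 6) (+ 7) (+ 3) Fa Fx Fy (F-quintuple d) (solve (a ∷ x ∷ y ∷ d ∷ []))
      TP : T (d + + 4 * x - + 2 * a - + 2 * y)
      TP = lin₄ (- + 2) (+ 4) (- + 2) (- + 1) Ta Tx Ty (T-triple d) (solve (a ∷ x ∷ y ∷ d ∷ []))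
      ¬TB : ¬ T (- (+ 2 * d + + 2 * a + x + + 2 * y))
      ¬TB t = ¬Td (lin₄ (- + 1) (- + 2) (- + 1) (- + 2) t Ta Tx Ty (solve (a ∷ x ∷ y ∷ d ∷ [])))
      TC : T (- (y - + 4 * a - + 2 * x))
      TC = lin₄ (+ 4) (+ 2) (- + 1) (+ 1) Ta Tx Ty (T-triple d) (solve (a ∷ x ∷ y ∷ d ∷ []))
      ¬TD : ¬ T (a - + 2 * x - + 4 * y - + 2 * d)
      ¬TD t = ¬Td (lin₅ (- + 1) (+ 1) (- + 2) (- + 4) (+ 2) t Ta Tx Ty (T-triple d) (solve (a ∷ x ∷ y ∷ d ∷ [])))

    Y-good : ∀ m {P B C D} → Y m P B C D → Good n
    Y-good zero (Y-data _ _ _ _ _ _ _ _ small) = ⊥-elim (small (1∣ _))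
    Y-good (suc m) {P} {B} {C} {D} (Y-data r (divides a P≡) (divides b B≡) (divides c C≡) TP ¬TB TC ¬TD small) =
      either (T± ¬TB ¬TD)
        (λ t → Y-step₂ m a b c D r₅ Ta (T-2d+5b₂ {B} {D} b B≡ t) Tc ¬TD small-a)
        (λ t → Y-step₁ m a b c D r₅ Ta (T-2d+5b₁ {B} {D} b B≡ t) Tc ¬TD small-a)
      where
      r₅ : Rep₅ n a b c D
      r₅ = to-rep₅ a b c P≡ B≡ C≡ r
      Ta : T (a - + 0 * D)
      Ta = T-5a a D P≡ TP
      Tc : T (c - - + 1 * D)
      Tc = T-2d+5b c C≡ TC
      small-a : ¬ (+ 5) ^ m ∣ℤ a
      small-a = small ∘ ^-∣-suc (+ 5) m (trans P≡ (ℤ.*-comm a (+ 5)))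

    -- The case B ≡ D modulo 3; `Y-step₂` is B ≡ - D. They need separate checks because the residues
    -- modulo 3 decide which coordinates of the images are multiples of 3.
    Y-step₁ : ∀ m a b c d → Rep₅ n a b c d → T (a - + 0 * d) → T (b - + 1 * d) → T (c - - + 1 * d) → ¬ T d →
      ¬ (+ 5) ^ m ∣ℤ a → Good n
    Y-step₁ m a b c d r Ta Tb Tc ¬Td small = go (checkY₁ a b c d)
      where
      r⁻ : Rep₅ n (- a) b c d
      r⁻ = rep₅-neg a b c d r
      T-a : T (- a - + 0 * d)
      T-a = lin₁ (- + 1) Ta (solve (a ∷ d ∷ []))
      F-a : F a → F (- a)
      F-a Fa = lin₁ (- + 1) Fa (solve (a ∷ []))
      id₁ : ∀ b c a → - + 8 * a ≡ + 1 * (b - + 4 * a - + 2 * c) + - + 1 * (b - + 4 * - a - + 2 * c)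
      id₁ = solve-∀
      id₂ : ∀ b c d a → + 12 * a ≡ + 1 * (- (b - + 4 * a - + 2 * c) - - (+ 2 * d + + 2 * a + c + + 2 * b)) + - + 1 * (- (b - + 4 * - a - + 2 * c) - - (+ 2 * d + + 2 * - a + c + + 2 * b))
      id₂ = solve-∀
      go : CheckY₁ a b c d → Good n
      go (inj₁ Fd) = ⊥-elim (¬F-d d (F-d²+n a b c d r) Fd)
      go (inj₂ (inj₁ h)) = hits (+ 0) (+ 1) (- + 1) _ a b c d r Ta Tb Tc h
      go (inj₂ (inj₂ (inj₁ h))) = hits (+ 0) (+ 1) (- + 1) _ (- a) b c d r⁻ T-a Tb Tc h
      go (inj₂ (inj₂ (inj₂ (inj₁ h)))) = hits (+ 0) (- + 1) (+ 1) _ a c b d (rep₅-swap a b c d r) Ta Tc Tb h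
      go (inj₂ (inj₂ (inj₂ (inj₂ (inj₁ h))))) = hits (+ 0) (- + 1) (+ 1) _ (- a) c b d (rep₅-swap (- a) b c d r⁻) T-a Tc Tb h
      go (inj₂ (inj₂ (inj₂ (inj₂ (inj₂ (inj₁ (Fa , R))))))) =
        either (choose-sign m (λ a → Image.y′ a c b d) (- + 8) (from-no (+ 5 ∣? - + 8)) (id₁ b c) a small)
          (Y-image₁ m a c b d (rep₅-swap a b c d r) Ta Tc Tb ¬Td Fa R)
          (Y-image₁ m (- a) c b d (rep₅-swap (- a) b c d r⁻) T-a Tc Tb ¬Td (F-a Fa) R)
      go (inj₂ (inj₂ (inj₂ (inj₂ (inj₂ (inj₂ (Fa , R))))))) =
        either (choose-sign m (λ a → - Image.y′ a c b d - - Image.d′ a c b d) (+ 12) (from-no (+ 5 ∣? + 12)) (id₂ b c d) a small)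
          (Y-image₂ m a c b d (rep₅-swap a b c d r) Ta Tc Tb ¬Td Fa R)
          (Y-image₂ m (- a) c b d (rep₅-swap (- a) b c d r⁻) T-a Tc Tb ¬Td (F-a Fa) R)

    Y-step₂ : ∀ m a b c d → Rep₅ n a b c d → T (a - + 0 * d) → T (b - + 0 * d) → T (c - - + 1 * d) → ¬ T d →
      ¬ (+ 5) ^ m ∣ℤ a → Good n
    Y-step₂ m a b c d r Ta Tb Tc ¬Td small = go (checkY₂ a b c d)
      where
      r⁻ : Rep₅ n (- a) b c d
      r⁻ = rep₅-neg a b c d r
      T-a : T (- a - + 0 * d)
      T-a = lin₁ (- + 1) Ta (solve (a ∷ d ∷ []))
      F-a : F a → F (- a)
      F-a Fa = lin₁ (- + 1) Fa (solve (a ∷ []))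
      id₁ : ∀ b c d a → - + 4 * a ≡ + 1 * (d + + 4 * b - + 2 * a - + 2 * c) + - + 1 * (d + + 4 * b - + 2 * - a - + 2 * c)
      id₁ = solve-∀
      id₂ : ∀ b c d a → + 4 * a ≡ + 1 * (+ 2 * d + + 2 * a + b + + 2 * c) + - + 1 * (+ 2 * d + + 2 * - a + b + + 2 * c)
      id₂ = solve-∀
      go : CheckY₂ a b c d → Good n
      go (inj₁ Fd) = ⊥-elim (¬F-d d (F-d²+n a b c d r) Fd)
      go (inj₂ (inj₁ h)) = hits (+ 0) (+ 0) (- + 1) _ a b c d r Ta Tb Tc h
      go (inj₂ (inj₂ (inj₁ h))) = hits (+ 0) (+ 0) (- + 1) _ (- a) b c d r⁻ T-a Tb Tc h
      go (inj₂ (inj₂ (inj₂ (inj₁ h)))) = hits (+ 0) (- + 1) (+ 0) _ a c b d (rep₅-swap a b c d r) Ta Tc Tb h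
      go (inj₂ (inj₂ (inj₂ (inj₂ (inj₁ h))))) = hits (+ 0) (- + 1) (+ 0) _ (- a) c b d (rep₅-swap (- a) b c d r⁻) T-a Tc Tb h
      go (inj₂ (inj₂ (inj₂ (inj₂ (inj₂ (inj₁ (Fa , R))))))) =
        either (choose-sign m (λ a → Image.x′ a b c d) (- + 4) (from-no (+ 5 ∣? - + 4)) (id₁ b c d) a small)
          (Y-image₃ m a b c d r Ta Tb Tc ¬Td Fa R)
          (Y-image₃ m (- a) b c d r⁻ T-a Tb Tc ¬Td (F-a Fa) R)
      go (inj₂ (inj₂ (inj₂ (inj₂ (inj₂ (inj₂ (Fa , R))))))) =
        either (choose-sign m (λ a → Image.d′ a b c d) (+ 4) (from-no (+ 5 ∣? + 4)) (id₂ b c d) a small)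
          (Y-image₄ m a b c d r Ta Tb Tc ¬Td Fa R)
          (Y-image₄ m (- a) b c d r⁻ T-a Tb Tc ¬Td (F-a Fa) R)

    -- Modulo 5 the image is (- 2 d, d, 0, 2 d).
    Y-image₁ : ∀ m a x y d → Rep₅ n a x y d → T (a - + 0 * d) → T (x - - + 1 * d) → T (y - + 1 * d) → ¬ T d →
      F a → F (x + + 2 * y) → ¬ (+ 5) ^ m ∣ℤ Image.y′ a x y d → Good n
    Y-image₁ m a x y d r Ta Tx Ty ¬Td Fa R small = Y-good m (Y-data r′ FP FB FC TP ¬TB TC ¬TD small)
      where
      r′ : let open Image a x y d in Rep n y′ (- a′) d′ x′
      r′ = rep-neg₂ (rep-swap₃₄ (rep-swap₁₂ (rep-swap₂₃ (image a x y d r))))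
      FP : F (y - + 4 * a - + 2 * x)
      FP = lin₃ (- + 4) (- + 2) (+ 1) Fa R (F-quintuple y) (solve (a ∷ x ∷ y ∷ []))
      FB : F (- (a - + 2 * x - + 4 * y - + 2 * d) - + 2 * (d + + 4 * x - + 2 * a - + 2 * y))
      FB = lin₃ (+ 3) (- + 6) (+ 4) Fa R (F-quintuple y) (solve (a ∷ x ∷ y ∷ d ∷ []))
      FC : F (+ 2 * d + + 2 * a + x + + 2 * y - + 2 * (d + + 4 * x - + 2 * a - + 2 * y))
      FC = lin₃ (+ 6) (- + 7) (+ 4) Fa R (F-quintuple y) (solve (a ∷ x ∷ y ∷ d ∷ []))
      TP : T (y - + 4 * a - + 2 * x)
      TP = lin₄ (- + 4) (- + 2) (+ 1) (+ 1) Ta Tx Ty (T-triple d) (solve (a ∷ x ∷ y ∷ d ∷ []))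
      ¬TB : ¬ T (- (a - + 2 * x - + 4 * y - + 2 * d))
      ¬TB t = ¬Td (lin₅ (+ 1) (+ 1) (- + 2) (- + 4) (- + 1) t Ta Tx Ty (T-triple d) (solve (a ∷ x ∷ y ∷ d ∷ [])))
      TC : T (+ 2 * d + + 2 * a + x + + 2 * y)
      TC = lin₄ (+ 2) (+ 1) (+ 2) (+ 1) Ta Tx Ty (T-triple d) (solve (a ∷ x ∷ y ∷ d ∷ []))
      ¬TD : ¬ T (d + + 4 * x - + 2 * a - + 2 * y)
      ¬TD t = ¬Td (lin₅ (+ 1) (+ 2) (- + 4) (+ 2) (+ 2) t Ta Tx Ty (T-triple d) (solve (a ∷ x ∷ y ∷ d ∷ [])))

    -- Modulo 5 the image is (d, 0, - 2 d, - 2 d). Modulo 3 the last two coordinates vanish, so it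
    -- is `X`.
    Y-image₂ : ∀ m a x y d → Rep₅ n a x y d → T (a - + 0 * d) → T (x - - + 1 * d) → T (y - + 1 * d) → ¬ T d →
      F a → F (x + + 2 * y - d) → ¬ (+ 5) ^ m ∣ℤ - Image.y′ a x y d - - Image.d′ a x y d → Good n
    Y-image₂ m a x y d r Ta Tx Ty ¬Td Fa R small = X-good m (X-data r′ FP FB FC TP+D TB TC ¬TD small)
      where
      r′ : let open Image a x y d in Rep n x′ (- y′) (- d′) a′
      r′ = rep-neg₃ (rep-neg₂ (rep-swap₃₄ (rep-swap₂₃ (rep-swap₁₂ (image a x y d r)))))
      FP : F (d + + 4 * x - + 2 * a - + 2 * y)
      FP = lin₃ (- + 2) (+ 4) (+ 1) Fa R (F-quintuple (d - + 2 * y)) (solve (a ∷ x ∷ y ∷ d ∷ []))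
      FB : F (- (y - + 4 * a - + 2 * x) - + 2 * (a - + 2 * x - + 4 * y - + 2 * d))
      FB = lin₃ (+ 2) (+ 6) (+ 1) Fa R (F-quintuple (+ 2 * d - y)) (solve (a ∷ x ∷ y ∷ d ∷ []))
      FC : F (- (+ 2 * d + + 2 * a + x + + 2 * y) - + 2 * (a - + 2 * x - + 4 * y - + 2 * d))
      FC = lin₃ (- + 4) (+ 3) (+ 1) Fa R (F-quintuple d) (solve (a ∷ x ∷ y ∷ d ∷ []))
      TP+D : T (d + + 4 * x - + 2 * a - + 2 * y + (a - + 2 * x - + 4 * y - + 2 * d))
      TP+D = lin₃ (- + 1) (+ 2) (- + 1) Ta Tx (T-triple (+ 2 * y + d)) (solve (a ∷ x ∷ y ∷ d ∷ []))
      TB : T (- (y - + 4 * a - + 2 * x))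
      TB = lin₄ (+ 4) (+ 2) (- + 1) (- + 1) Ta Tx Ty (T-triple d) (solve (a ∷ x ∷ y ∷ d ∷ []))
      TC : T (- (+ 2 * d + + 2 * a + x + + 2 * y))
      TC = lin₄ (- + 2) (- + 1) (- + 2) (- + 1) Ta Tx Ty (T-triple d) (solve (a ∷ x ∷ y ∷ d ∷ []))
      ¬TD : ¬ T (a - + 2 * x - + 4 * y - + 2 * d)
      ¬TD t = ¬Td (lin₅ (- + 1) (+ 1) (- + 2) (- + 4) (- + 1) t Ta Tx Ty (T-triple d) (solve (a ∷ x ∷ y ∷ d ∷ [])))

    -- The image is the same modulo 5 as in `Y-image₂`, but modulo 3 its second coordinate vanishes
    -- and its third does not, so it is `Y`.
    Y-image₃ : ∀ m a x y d → Rep₅ n a x y d → T (a - + 0 * d) → T (x - + 0 * d) → T (y - - + 1 * d) → ¬ T d →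
      F a → F (x + + 2 * y - d) → ¬ (+ 5) ^ m ∣ℤ Image.x′ a x y d → Good n
    Y-image₃ m a x y d r Ta Tx Ty ¬Td Fa R small = Y-good m (Y-data r′ FP FB FC TP ¬TB TC ¬TD small)
      where
      r′ : let open Image a x y d in Rep n x′ (- y′) (- d′) a′
      r′ = rep-neg₃ (rep-neg₂ (rep-swap₃₄ (rep-swap₂₃ (rep-swap₁₂ (image a x y d r)))))
      FP : F (d + + 4 * x - + 2 * a - + 2 * y)
      FP = lin₃ (- + 2) (+ 4) (+ 1) Fa R (F-quintuple (d - + 2 * y)) (solve (a ∷ x ∷ y ∷ d ∷ []))
      FB : F (- (y - + 4 * a - + 2 * x) - + 2 * (a - + 2 * x - + 4 * y - + 2 * d))
      FB = lin₃ (+ 2) (+ 6) (+ 1) Fa R (F-quintuple (+ 2 * d - y)) (solve (a ∷ x ∷ y ∷ d ∷ []))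
      FC : F (- (+ 2 * d + + 2 * a + x + + 2 * y) - + 2 * (a - + 2 * x - + 4 * y - + 2 * d))
      FC = lin₃ (- + 4) (+ 3) (+ 1) Fa R (F-quintuple d) (solve (a ∷ x ∷ y ∷ d ∷ []))
      TP : T (d + + 4 * x - + 2 * a - + 2 * y)
      TP = lin₄ (- + 2) (+ 4) (- + 2) (+ 1) Ta Tx Ty (T-triple d) (solve (a ∷ x ∷ y ∷ d ∷ []))
      ¬TB : ¬ T (- (y - + 4 * a - + 2 * x))
      ¬TB t = ¬Td (lin₄ (+ 1) (- + 4) (- + 2) (+ 1) t Ta Tx Ty (solve (a ∷ x ∷ y ∷ d ∷ [])))
      TC : T (- (+ 2 * d + + 2 * a + x + + 2 * y))
      TC = lin₃ (- + 2) (- + 1) (- + 2) Ta Tx Ty (solve (a ∷ x ∷ y ∷ d ∷ []))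
      ¬TD : ¬ T (a - + 2 * x - + 4 * y - + 2 * d)
      ¬TD t = ¬Td (lin₅ (- + 1) (+ 1) (- + 2) (- + 4) (+ 1) t Ta Tx Ty (T-triple d) (solve (a ∷ x ∷ y ∷ d ∷ [])))

    -- Modulo 5 the image is (2 d, 3 d, - d, 0), so - d plays the role of d.
    Y-image₄ : ∀ m a x y d → Rep₅ n a x y d → T (a - + 0 * d) → T (x - + 0 * d) → T (y - - + 1 * d) → ¬ T d →
      F a → F (x + + 2 * y - + 3 * d) → ¬ (+ 5) ^ m ∣ℤ Image.d′ a x y d → Good n
    Y-image₄ m a x y d r Ta Tx Ty ¬Td Fa R small = Y-good m (Y-data r′ FP FB FC TP ¬TB TC ¬TD small)
      where
      r′ : let open Image a x y d in Rep n d′ (- a′) x′ y′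
      r′ = rep-neg₂ (rep-swap₁₂ (rep-swap₂₃ (rep-swap₃₄ (image a x y d r))))
      FP : F (+ 2 * d + + 2 * a + x + + 2 * y)
      FP = lin₃ (+ 2) (+ 1) (+ 1) Fa R (F-quintuple d) (solve (a ∷ x ∷ y ∷ d ∷ []))
      FB : F (- (a - + 2 * x - + 4 * y - + 2 * d) - + 2 * (y - + 4 * a - + 2 * x))
      FB = lin₃ (+ 7) (+ 6) (+ 1) Fa R (F-quintuple (+ 4 * d - + 2 * y)) (solve (a ∷ x ∷ y ∷ d ∷ []))
      FC : F (d + + 4 * x - + 2 * a - + 2 * y - + 2 * (y - + 4 * a - + 2 * x))
      FC = lin₃ (+ 6) (+ 8) (+ 1) Fa R (F-quintuple (+ 5 * d - + 4 * y)) (solve (a ∷ x ∷ y ∷ d ∷ []))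
      TP : T (+ 2 * d + + 2 * a + x + + 2 * y)
      TP = lin₃ (+ 2) (+ 1) (+ 2) Ta Tx Ty (solve (a ∷ x ∷ y ∷ d ∷ []))
      ¬TB : ¬ T (- (a - + 2 * x - + 4 * y - + 2 * d))
      ¬TB t = ¬Td (lin₅ (+ 1) (+ 1) (- + 2) (- + 4) (+ 1) t Ta Tx Ty (T-triple d) (solve (a ∷ x ∷ y ∷ d ∷ [])))
      TC : T (d + + 4 * x - + 2 * a - + 2 * y)
      TC = lin₄ (- + 2) (+ 4) (- + 2) (+ 1) Ta Tx Ty (T-triple d) (solve (a ∷ x ∷ y ∷ d ∷ []))
      ¬TD : ¬ T (y - + 4 * a - + 2 * x)
      ¬TD t = ¬Td (lin₄ (- + 1) (- + 4) (- + 2) (+ 1) t Ta Tx Ty (solve (a ∷ x ∷ y ∷ d ∷ [])))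

  F-double : ∀ B D → F (D * D + n) → F (B - + 2 * D) → ¬ F B
  F-double B D FD e r = ¬F-d D FD (F-half D (lin₂ (+ 1) (- + 1) r e (solve (B ∷ D ∷ []))))

  Y-start : ∀ {P B C D} → Rep n P B C D → F P → F (B - + 2 * D) → F (C - + 2 * D) → F (D * D + n) →
    T P → ¬ T B → T C → ¬ T D → Good n
  Y-start {P} {B} {C} {D} r FP FB FC FD TP ¬TB TC ¬TD with P ℤ.≟ + 0
  ... | yes P≡0 = P , B , C , D , r , inj₁ P≡0 , inj₂ (F-double B D FD FB) , inj₂ (F-double C D FD FC) , inj₂ (¬F-d D FD)
  ... | no P≢0 = let m , small = ^-∤ 5 (s≤s (s≤s z≤n)) P≢0 in Y-good m (Y-data r FP FB FC TP ¬TB TC ¬TD small)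

  X-start : ∀ {P B C D} → Rep n P B C D → F P → F (B - + 2 * D) → F (C - + 2 * D) → F (D * D + n) →
    T (P + D) → T B → T C → ¬ T D → Good n
  X-start {P} {B} {C} {D} r FP FB FC FD TP+D TB TC ¬TD = start ((B - C) ℤ.≟ + 0)
    where
    sum : T (P + D + + 2 * B)
    sum = lin₂ (+ 1) (+ 2) TP+D TB (solve (P ∷ D ∷ B ∷ []))

    -- Substituting P = - (D + 2 B) turns P² + 2 B² + D² into 6 B² + 4 B D + 2 D² = (2 B)² + 2 (B +
    -- D)². As B ≡ 2 D modulo 5, both 2 B and B + D are prime to 5.
    orthogonal : P + D + + 2 * B ≡ + 0 → Rep n P B B D → Good n
    orthogonal eq (rep s) = - + 2 * B , B + D , B + D , + 0 ,
      rep (trans (id P B D) (trans (cong (λ z → P * P + B * B + B * B + D * D - z * (P - D - + 2 * B)) eq) (trans (ℤ.+-identityʳ _) s))) ,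
      inj₂ (λ q → F-double B D FD FB (F-half B (lin₁ (- + 1) q (solve (B ∷ []))))) ,
      inj₂ ¬FB+D , inj₂ ¬FB+D , inj₁ refl
      where
      id : ∀ P B D → - + 2 * B * (- + 2 * B) + (B + D) * (B + D) + (B + D) * (B + D) + + 0 * + 0 ≡
        P * P + B * B + B * B + D * D - (P + D + + 2 * B) * (P - D - + 2 * B)
      id = solve-∀
      ¬FB+D : ¬ F (B + D)
      ¬FB+D q = ¬F-d D FD (lin₃ (+ 2) (- + 2) (- + 1) q FB (F-quintuple D) (solve (B ∷ D ∷ [])))

    -- The reflection in (1, 2, 0, 1).
    reflected : ∀ t → P + D + + 2 * B ≡ t * + 3 → Rep n P B B D → Rep n (P - t) (B - + 2 * t) B (D - t)
    reflected t eq (rep s) = rep (trans (id P B D t) (trans (cong (λ z → P * P + B * B + B * B + D * D + + 2 * t * (t * + 3 - z)) eq)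
      (trans (id′ (P * P + B * B + B * B + D * D) t) s)))
      where
      id : ∀ P B D t → (P - t) * (P - t) + (B - + 2 * t) * (B - + 2 * t) + B * B + (D - t) * (D - t) ≡
        P * P + B * B + B * B + D * D + + 2 * t * (t * + 3 - (P + D + + 2 * B))
      id = solve-∀
      id′ : ∀ z t → z + + 2 * t * (t * + 3 - t * + 3) ≡ z
      id′ = solve-∀

    -- Modulo 5, P + D + 2 B ≡ 5 D ≡ 0, so 5 divides t and the reflection keeps the normal form
    -- while separating the equal entries by 2 t ≠ 0. Modulo 3, t ≡ 0 gives `X`, t ≡ - D gives `Y`,
    -- and t ≡ D makes the last entry a multiple of 3.
    nudged : ∀ t → t ≢ + 0 → P + D + + 2 * B ≡ t * + 3 → Rep n P B B D → Good n
    nudged t t≢0 eq r = split (trichotomy3 t ¬TD)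
      where
      r′ : Rep n (P - t) (B - + 2 * t) B (D - t)
      r′ = reflected t eq r
      Ft : F t
      Ft = lin₄ (+ 2) (+ 4) (- + 2) (- + 1) FP FB (≡⇒∣ eq) (F-quintuple (t - + 2 * D)) (solve (P ∷ B ∷ D ∷ t ∷ []))
      FP′ : F (P - t)
      FP′ = ∣m∣n⇒∣m-n FP Ft
      FB′ : F (B - + 2 * t - + 2 * (D - t))
      FB′ = lin₁ (+ 1) FB (solve (B ∷ D ∷ t ∷ []))
      FC′ : F (B - + 2 * (D - t))
      FC′ = lin₂ (+ 1) (+ 2) FB Ft (solve (B ∷ D ∷ t ∷ []))
      FD′ : F ((D - t) * (D - t) + n)
      FD′ = F-congruent (D - t) D (lin₁ (- + 1) Ft (solve (D ∷ t ∷ []))) FD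
      split : T t ⊎ T (t - D) ⊎ T (t + D) → Good n
      split (inj₁ Tt) =
        let m , small = ^-∤ 5 (s≤s (s≤s z≤n)) -2t≢0 in X-good m (X-data r′ FP′ FB′ FC′ TP+D′ TB′ TB ¬TD′ small)
        where
        -2t≢0 : B - + 2 * t - B ≢ + 0
        -2t≢0 e = either (ℤ.i*j≡0⇒i≡0∨j≡0 (- + 2) (trans (id B t) e)) (λ ()) t≢0
          where
          id : ∀ B t → - + 2 * t ≡ B - + 2 * t - B
          id = solve-∀
        TP+D′ : T (P - t + (D - t))
        TP+D′ = lin₂ (+ 1) (- + 2) TP+D Tt (solve (P ∷ D ∷ t ∷ []))
        TB′ : T (B - + 2 * t)
        TB′ = lin₂ (+ 1) (- + 2) TB Tt (solve (B ∷ t ∷ []))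
        ¬TD′ : ¬ T (D - t)
        ¬TD′ q = ¬TD (lin₂ (+ 1) (+ 1) q Tt (solve (D ∷ t ∷ [])))
      split (inj₂ (inj₁ t≡D)) = criterion₂ r′ (lin₁ (- + 1) t≡D (solve (D ∷ t ∷ []))) FD′
      split (inj₂ (inj₂ t≡-D)) = Y-start r′ FP′ FB′ FC′ FD′ TP′ ¬TB′ TB ¬TD′
        where
        TP′ : T (P - t)
        TP′ = lin₂ (+ 1) (- + 1) TP+D t≡-D (solve (P ∷ D ∷ t ∷ []))
        ¬TB′ : ¬ T (B - + 2 * t)
        ¬TB′ q = ¬TD (lin₄ (- + 1) (+ 1) (+ 1) (- + 1) q TB t≡-D (T-triple t) (solve (B ∷ D ∷ t ∷ [])))
        ¬TD′ : ¬ T (D - t)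
        ¬TD′ q = ¬TD (lin₃ (- + 1) (- + 1) (+ 1) q t≡-D (T-triple D) (solve (D ∷ t ∷ [])))

    go : ∀ C → B ≡ C → Rep n P B C D → T (P + D + + 2 * B) → Good n
    go _ refl r (divides t eq) with t ℤ.≟ + 0
    ... | yes refl = orthogonal eq r
    ... | no t≢0 = nudged t t≢0 eq r

    start : Dec (B - C ≡ + 0) → Good n
    start (no B≢C) = let m , small = ^-∤ 5 (s≤s (s≤s z≤n)) B≢C in X-good m (X-data r FP FB FC TP+D TB TC ¬TD small)
    start (yes B≡C) = go _ (ℤ.i-j≡0⇒i≡j B C B≡C) r sum

-- Normalisation modulo 5

module FiveCase (5-prime : Prime 5) (3<5 : 3 < 5) {n : ℤ} (¬Fn : ¬ F n) (n≢1 : ¬ T (n - + 1))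
  (±1 : F (n - + 1) ⊎ F (n + + 1)) where
  open Unit 5-prime 3<5 using (P?)
  open Good 5-prime 3<5
  open Five 5-prime 3<5 ¬Fn n≢1

  square≡±n : ∀ {x} → ¬ F x → F (x * x - + 1 * n) ⊎ F (x * x - - + 1 * n)
  square≡±n {x} ¬Fx = go ±1 (F-square ¬Fx)
    where
    go : F (n - + 1) ⊎ F (n + + 1) → F (x * x - + 1) ⊎ F (x * x + + 1) → F (x * x - + 1 * n) ⊎ F (x * x - - + 1 * n)
    go (inj₁ r) (inj₁ s) = inj₁ (lin₂ (- + 1) (+ 1) r s (solve (x ∷ n ∷ [])))
    go (inj₁ r) (inj₂ s) = inj₂ (lin₂ (+ 1) (+ 1) r s (solve (x ∷ n ∷ [])))
    go (inj₂ r) (inj₁ s) = inj₂ (lin₂ (+ 1) (+ 1) r s (solve (x ∷ n ∷ [])))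
    go (inj₂ r) (inj₂ s) = inj₁ (lin₂ (- + 1) (+ 1) r s (solve (x ∷ n ∷ [])))

  -- Modulo 5 the sum of squares reads n ≡ (β + γ + δ) n. Three signs therefore have to be + 1, + 1,
  -- - 1 in some order.
  inconsistent : ∀ β γ δ {a b c d} → Rep n a b c d → F a → F (b * b - β * n) → F (c * c - γ * n) → F (d * d - δ * n) →
    ¬ F (+ 1 - β - γ - δ) → ⊥
  inconsistent β γ δ {a} {b} {c} {d} (rep s) Fa Fb Fc Fd ≢0 =
    either (prime-∣ℤ-* 5-prime (+ 1 - β - γ - δ) n
      (lin₄ a (+ 1) (+ 1) (+ 1) Fa Fb Fc Fd (trans (id₁ β γ δ n) (trans (cong (_- (β + γ + δ) * n) (sym s)) (id₂ β γ δ n a b c d)))))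
      ≢0 ¬Fn
    where
    id₁ : ∀ β γ δ n → (+ 1 - β - γ - δ) * n ≡ n - (β + γ + δ) * n
    id₁ = solve-∀
    id₂ : ∀ β γ δ n a b c d → a * a + b * b + c * c + d * d - (β + γ + δ) * n ≡
      a * a + + 1 * (b * b - β * n) + + 1 * (c * c - γ * n) + + 1 * (d * d - δ * n)
    id₂ = solve-∀

  twoUnits : ∀ {a b c d} → Rep n a b c d → ¬ T a → T b → T c → ¬ T d → T (n + + 1)
  twoUnits {a} {b} {c} {d} (rep s) ¬Ta Tb Tc ¬Td =
    subst (λ n → T (n + + 1)) s (lin₅ (+ 1) b c (+ 1) (+ 1) (T-square-1 ¬Ta) Tb Tc (T-square-1 ¬Td) (T-triple (+ 1)) (id a b c d))
    where
    id : ∀ a b c d → a * a + b * b + c * c + d * d + + 1 ≡ + 1 * (a * a - + 1) + b * b + c * c + + 1 * (d * d - + 1) + + 1 * (+ 3 * + 1)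
    id = solve-∀

  good-normalised : ∀ {a b c d} → Rep n a b c d → F a → F (b - + 2 * d) → F (c - + 2 * d) → F (d * d + n) → Good n
  good-normalised {a} {b} {c} {d} r Fa Fb Fc Fd = go (shape n≢1 r)
    where
    ¬Fd : ¬ F d
    ¬Fd s = ¬Fn (lin₂ (+ 1) (- d) Fd s (solve (d ∷ n ∷ [])))
    go : Shape a b c d → Good n
    go (reflectable o) = criterion Fd o r
    go (uuuz ¬Ta ¬Tb ¬Tc Td) = uuuz-good r Fa Fb Fc ¬Fd Fd ¬Ta ¬Tb ¬Tc Td
    go (uzzu ¬Ta Tb Tc ¬Td) = either (T± ¬Ta ¬Td)
      (λ t → X-start r Fa Fb Fc Fd t Tb Tc ¬Td)
      (λ t → X-start (rep-neg₁ r) (lin₁ (- + 1) Fa (solve (a ∷ []))) Fb Fc Fd (lin₁ (- + 1) t (solve (a ∷ d ∷ []))) Tb Tc ¬Td)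
      where open XY 5-prime 3<5 ¬Fn n≢1 (twoUnits r ¬Ta Tb Tc ¬Td)
    go (zuzu Ta ¬Tb Tc ¬Td) = Y-start r Fa Fb Fc Fd Ta ¬Tb Tc ¬Td
      where open XY 5-prime 3<5 ¬Fn n≢1 (twoUnits (rep-swap₁₂ r) ¬Tb Ta Tc ¬Td)
    go (zzuu Ta Tb ¬Tc ¬Td) = Y-start (rep-swap₂₃ r) Fa Fc Fb Fd Ta ¬Tc Tb ¬Td
      where open XY 5-prime 3<5 ¬Fn n≢1 (twoUnits (rep-swap₁₂ (rep-swap₂₃ r)) ¬Tc Ta Tb ¬Td)

  -- Modulo 5, b² ≡ n ≡ - d² ≡ (2 d)².
  ≡±2d : ∀ b d → F (b * b - + 1 * n) → F (d * d + n) → F (b - + 2 * d) ⊎ F (b + + 2 * d)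
  ≡±2d b d Fb Fd = prime-∣ℤ-* 5-prime (b - + 2 * d) (b + + 2 * d)
    (lin₃ (+ 1) (+ 1) (- + 1) Fb Fd (F-quintuple (d * d)) (solve (b ∷ d ∷ n ∷ [])))

  good-opposite : ∀ {a b c d} → Rep n a b c d → F a → F (b * b - + 1 * n) → F (c * c - + 1 * n) → F (d * d - - + 1 * n) → Good n
  good-opposite {a} {b} {c} {d} r Fa Fb Fc Fd′ =
    either (≡±2d b d Fb Fd)
      (λ s → with-b r s)
      (λ s → with-b (rep-neg₂ r) (lin₁ (- + 1) s (solve (b ∷ d ∷ []))))
    where
    Fd : F (d * d + n)
    Fd = lin₁ (+ 1) Fd′ (solve (d ∷ n ∷ []))
    with-b : ∀ {b} → Rep n a b c d → F (b - + 2 * d) → Good n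
    with-b r s = either (≡±2d c d Fc Fd)
      (λ t → good-normalised r Fa s t Fd)
      (λ t → good-normalised (rep-neg₃ r) Fa s (lin₁ (- + 1) t (solve (c ∷ d ∷ []))) Fd)

  good₁ : ∀ {a b c d} → F a → ¬ F b → ¬ F c → ¬ F d → Rep n a b c d → Good n
  good₁ {a} {b} {c} {d} Fa ¬Fb ¬Fc ¬Fd r = go (square≡±n ¬Fb) (square≡±n ¬Fc) (square≡±n ¬Fd)
    where
    go : F (b * b - + 1 * n) ⊎ F (b * b - - + 1 * n) → F (c * c - + 1 * n) ⊎ F (c * c - - + 1 * n) →
      F (d * d - + 1 * n) ⊎ F (d * d - - + 1 * n) → Good n
    go (inj₁ x) (inj₁ y) (inj₂ z) = good-opposite r Fa x y z
    go (inj₁ x) (inj₂ y) (inj₁ z) = good-opposite (rep-swap₃₄ r) Fa x z y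
    go (inj₂ x) (inj₁ y) (inj₁ z) = good-opposite (rep-swap₃₄ (rep-swap₂₃ r)) Fa y z x
    go (inj₁ x) (inj₁ y) (inj₁ z) = ⊥-elim (inconsistent (+ 1) (+ 1) (+ 1) r Fa x y z (from-no (+ 5 ∣? - + 2)))
    go (inj₁ x) (inj₂ y) (inj₂ z) = ⊥-elim (inconsistent (+ 1) (- + 1) (- + 1) r Fa x y z (from-no (+ 5 ∣? + 2)))
    go (inj₂ x) (inj₁ y) (inj₂ z) = ⊥-elim (inconsistent (- + 1) (+ 1) (- + 1) r Fa x y z (from-no (+ 5 ∣? + 2)))
    go (inj₂ x) (inj₂ y) (inj₁ z) = ⊥-elim (inconsistent (- + 1) (- + 1) (+ 1) r Fa x y z (from-no (+ 5 ∣? + 2)))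
    go (inj₂ x) (inj₂ y) (inj₂ z) = ⊥-elim (inconsistent (- + 1) (- + 1) (- + 1) r Fa x y z (from-no (+ 5 ∣? + 4)))

  open Multiples n≢1 good₁

  F-square-0 : ∀ {x} → F x → F (x * x - + 0 * n)
  F-square-0 {x} Fx = lin₁ x Fx (solve (x ∷ n ∷ []))

  -- This case is void: the two remaining signs add up to 2, 0 or - 2, never to 1 modulo 5.
  good₂ : ∀ {a b c d} → F a → F b → ¬ F c → ¬ F d → Rep n a b c d → Good n
  good₂ {a} {b} {c} {d} Fa Fb ¬Fc ¬Fd r = ⊥-elim (go (square≡±n ¬Fc) (square≡±n ¬Fd))
    where
    go : F (c * c - + 1 * n) ⊎ F (c * c - - + 1 * n) → F (d * d - + 1 * n) ⊎ F (d * d - - + 1 * n) → ⊥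
    go (inj₁ y) (inj₁ z) = inconsistent (+ 0) (+ 1) (+ 1) r Fa (F-square-0 Fb) y z (from-no (+ 5 ∣? - + 1))
    go (inj₁ y) (inj₂ z) = inconsistent (+ 0) (+ 1) (- + 1) r Fa (F-square-0 Fb) y z (from-no (+ 5 ∣? + 1))
    go (inj₂ y) (inj₁ z) = inconsistent (+ 0) (- + 1) (+ 1) r Fa (F-square-0 Fb) y z (from-no (+ 5 ∣? + 1))
    go (inj₂ y) (inj₂ z) = inconsistent (+ 0) (- + 1) (- + 1) r Fa (F-square-0 Fb) y z (from-no (+ 5 ∣? + 3))

  good₄ : ∀ {a b c d} → F a → F b → F c → F d → Rep n a b c d → Good n
  good₄ {a} {b} {c} {d} Fa Fb Fc Fd (rep s) = ⊥-elim (¬Fn (lin₄ a b c d Fa Fb Fc Fd (sym s)))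

  good : ∀ {a b c d} → Rep n a b c d → Good n
  good = Sort.sort P? (λ a b c d → Rep n a b c d → Good n) (_∘ rep-swap₁₂) (_∘ rep-swap₂₃) (_∘ rep-swap₃₄)
    (λ ¬Fa ¬Fb ¬Fc ¬Fd r → _ , _ , _ , _ , r , inj₂ ¬Fa , inj₂ ¬Fb , inj₂ ¬Fc , inj₂ ¬Fd) good₁ good₂ good₃ good₄ _ _ _ _

-- Removal of zeros and the gcd condition

module Assemble {p : ℕ} (p-prime : Prime p) (3<p : 3 < p) where
  open Unit p-prime 3<p using (P)
  open Good p-prime 3<p

  gcd≡1 : ∀ {m} → ¬ p ∣ m → ℕ.gcd p m ≡ 1
  gcd≡1 {m} p∤m with prime⇒irreducible p-prime (ℕ.gcd[m,n]∣m p m)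
  ... | inj₁ gcd≡1 = gcd≡1
  ... | inj₂ gcd≡p = ⊥-elim (p∤m (subst (_∣ m) gcd≡p (ℕ.gcd[m,n]∣n p m)))

  ¬P-prod : ∀ {k} (x : Fin k → ℤ) → (∀ i → ¬ P (x i)) → ¬ P (prodℤ x)
  ¬P-prod {zero} x ¬Px r = ℕ.>⇒∤ (ℕ.<-trans (s≤s (s≤s z≤n)) 3<p) (∣⇒∣ᵤ r)
  ¬P-prod {suc k} x ¬Px r = either (prime-∣ℤ-* p-prime (x zero) (prodℤ (x ∘ suc)) r) (¬Px zero) (¬P-prod (x ∘ suc) (¬Px ∘ suc))

  drop-zeros : ∀ m (x : Fin m → ℤ) → (∀ i → Admissible (x i)) →
    ∃[ k ] k ≤ m × ∃[ y ] sumSq {k} y ≡ sumSq x × (∀ i → ¬ P (y i))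
  drop-zeros zero x _ = 0 , z≤n , x , refl , λ ()
  drop-zeros (suc m) x ok with drop-zeros m (x ∘ suc) (ok ∘ suc) | ok zero
  ... | k , k≤m , y , eq , ¬Py | inj₁ x₀≡0 = k , ℕ.m≤n⇒m≤1+n k≤m , y ,
    trans eq (trans (sym (ℤ.+-identityˡ _)) (cong (λ z → z * z + sumSq (x ∘ suc)) (sym x₀≡0))) , ¬Py
  ... | k , k≤m , y , eq , ¬Py | inj₂ ¬Px₀ = suc k , s≤s k≤m , x zero VF.∷ y , cong (λ s → x zero * x zero + s) eq ,
    λ { zero → ¬Px₀ ; (suc i) → ¬Py i }

  good⇒isSumOfSquares : ∀ {n} → 1 ≤ n → Good (+ n) → ∃ λ k → 1 ≤ k × k ≤ 4 × IsSumOfSquaresNotDiv p k (+ n)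
  good⇒isSumOfSquares {n} 1≤n (a , b , c , d , rep s , oka , okb , okc , okd) =
    let k , k≤4 , y , eq , ¬Py = drop-zeros 4 x ok in
    k , positive k y (trans n≡ (sym eq)) , k≤4 , y , trans n≡ (sym eq) , cong +_ (gcd≡1 (¬P-prod y ¬Py ∘ ∣ᵤ⇒∣))
    where
    x : Fin 4 → ℤ
    x = a VF.∷ b VF.∷ c VF.∷ d VF.∷ VF.[]
    ok : ∀ i → Admissible (x i)
    ok zero = oka
    ok (suc zero) = okb
    ok (suc (suc zero)) = okc
    ok (suc (suc (suc zero))) = okd
    id : ∀ a b c d → a * a + b * b + c * c + d * d ≡ a * a + (b * b + (c * c + (d * d + + 0)))
    id = solve-∀
    n≡ : + n ≡ sumSq x
    n≡ = trans (sym s) (id a b c d)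
    positive : ∀ k (y : Fin k → ℤ) → + n ≡ sumSq y → 1 ≤ k
    positive zero y eq = ⊥-elim (ℕ.<⇒≢ 1≤n (sym (ℤ.+-injective eq)))
    positive (suc k) _ _ = s≤s z≤n

≢1-mod3 : ∀ n → n % 3 ≡ 0 ⊎ n % 3 ≡ 2 → ¬ T (+ n - + 1)
≢1-mod3 n e t = go e
  where
  n≡ : ∀ r → n % 3 ≡ r → + n ≡ + r + + (n ℕ./ 3) * + 3
  n≡ r eq = trans (cong +_ (trans (ℕ.m≡m%n+[m/n]*n n 3) (cong (ℕ._+ n ℕ./ 3 ℕ.* 3) eq))) (cong (λ z → + r + z) (ℤ.pos-* (n ℕ./ 3) 3))
  residue : ∀ r → n % 3 ≡ r → T (+ r - + 1)
  residue r eq = lin₃ (+ 1) (- + 1) (- + 1) t (≡⇒∣ (n≡ r eq)) (T-triple (+ (n ℕ./ 3))) (id (+ n) (+ r) (+ (n ℕ./ 3)))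
    where
    id : ∀ n r q → r - + 1 ≡ + 1 * (n - + 1) + - + 1 * (n - (r + q * + 3)) + - + 1 * (+ 3 * q)
    id = solve-∀
  go : n % 3 ≡ 0 ⊎ n % 3 ≡ 2 → ⊥
  go (inj₁ eq) = from-no (+ 3 ∣? - + 1) (residue 0 eq)
  go (inj₂ eq) = from-no (+ 3 ∣? + 1) (residue 2 eq)

prime∣5⇒≡5 : ∀ {p} → 3 < p → p ∣ 5 → p ≡ 5
prime∣5⇒≡5 {p} 3<p p∣5 with ℕ.m≤n⇒m<n∨m≡n (ℕ.∣⇒≤ p∣5)
... | inj₂ p≡5 = p≡5
... | inj₁ (s≤s p≤4) with refl ← ℕ.≤-antisym p≤4 3<p = ⊥-elim (from-no (4 ℕ.∣? 5) p∣5)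

theorem4p2 : (p n : ℕ) → Prime p → 3 < p → 1 ≤ n → ¬ (p ∣ n) →
    (n % 3 ≡ 0 ⊎ n % 3 ≡ 2) →
    ∃ λ k → 1 ≤ k × k ≤ 4 × IsSumOfSquaresNotDiv p k (+ n)
theorem4p2 p n p-prime 3<p 1≤n p∤n n%3 = good⇒isSumOfSquares 1≤n (good-n (p ℕ.≟ 5))
  where
  open Assemble p-prime 3<p
  open Good p-prime 3<p

  n≢1 : ¬ T (+ n - + 1)
  n≢1 = ≢1-mod3 n n%3

  R : Rep (+ n) _ _ _ _
  R = proj₂ (proj₂ (proj₂ (proj₂ (lagrange n))))

  good-n : Dec (p ≡ 5) → Good (+ n)
  good-n (no p≢5) = Generic.good (p∤n ∘ ∣⇒∣ᵤ) n≢1 (λ _ → p≢5 ∘ prime∣5⇒≡5 3<p ∘ ∣⇒∣ᵤ ∘ proj₁) R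
  good-n (yes refl) = go (mod5 (+ n))
    where
    go : Mod5 (+ n) → Good (+ n)
    go (zero r) = ⊥-elim (p∤n (∣⇒∣ᵤ r))
    go (±1 r) = FiveCase.good p-prime 3<p (p∤n ∘ ∣⇒∣ᵤ) n≢1 r R
    go (±2 r) = Generic.good (p∤n ∘ ∣⇒∣ᵤ) n≢1 (λ d → nonDegenerate-±2 (+ n) r d ∘ proj₂) R
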